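{- Let $\Phi=(D,\varphi)$ be a $\mathbb{T}$-gain digraph whose underlying digraph $D$ is strongly connected. Then the following are equivalent: (i) $\Phi$ is cycle balanced. (ii) $\Phi\sim(D,\mathbf{1})$, i.e., $\Phi$ has a potential function. (iii) $L(\Phi)$ is cospectral with $L(D)$. (iv) $0$ is an eigenvalue of $L(\Phi)$.
   Context: A digraph $D=(V,\mathcal{A})$ has a finite vertex set $V=\{v_1,\dots,v_n\}$ and a set $\mathcal{A}$ of ordered pairs of distinct vertices, called arcs (no loops; at most one arc from $v_i$ to $v_j$ for each ordered pair; opposite arcs may both be present). The out-degree $\deg^+(v)$ is the number of arcs leaving $v$. A directed cycle is a closed directed walk whose vertices are distinct except that the first and last coincide (so its length is at least $2$; length $2$ is allowed). $D$ is strongly connected if every ordered pair of vertices is joined by a directed path. Let $\mathbb{T}=\{z\in\mathbb{C}:|z|=1\}$. A $\mathbb{T}$-gain digraph is a pair $\Phi=(D,\varphi)$ with $\varphi:\mathcal{A}\to\mathbb{T}$ an arbitrary function (no relation between gains of opposite arcs). Its gain adjacency matrix $A(\Phi)$ has entries $A(\Phi)_{ij}=\varphi(v_i,v_j)$ if $(v_i,v_j)\in\mathcal{A}$ and $0$ otherwise; $A(D)$ is the $0/1$ adjacency matrix of $D$ (all gains $1$). With $D^+=\operatorname{diag}(\deg^+(v_1),\dots,\deg^+(v_n))$, the Laplacian matrices are $L(\Phi)=D^+-A(\Phi)$ and $L(D)=D^+-A(D)$. The gain $\varphi(C)$ of a directed cycle is the product of the gains of its arcs; $\Phi$ is cycle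 balanced if $\varphi(C)=1$ for every directed cycle $C$ of $D$. For $\sigma:V\to\mathbb{T}$, $\Phi^\sigma=(D,\varphi^\sigma)$ with $\varphi^\sigma(v_i,v_j)=\sigma(v_i)\varphi(v_i,v_j)\overline{\sigma(v_j)}$; $\Phi\sim\Phi'$ (switching equivalent) means $\Phi'=\Phi^\sigma$ for some $\sigma$. $(D,\mathbf{1})$ denotes $D$ with every arc given gain $1$. A potential function for $\varphi$ is a map $\psi:V\to\mathbb{T}$ with $\varphi(v_i,v_j)=\overline{\psi(v_i)}\,\psi(v_j)$ for every arc $(v_i,v_j)$; its existence means exactly $\Phi\sim(D,\mathbf{1})$. Two matrices are cospectral if they have the same characteristic polynomial. -}

module Defs where

open import Algebra.Bundles using (RawRing; CommutativeRing)
import Algebra.Definitions.RawMonoid as RawMonoidDefinitions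
open import Data.Bool.Base using (Bool; T; if_then_else_)
open import Data.Bool.Properties using (T?)
open import Data.Fin.Base using (Fin; zero; suc; toℕ; punchIn)
import Data.Fin.Properties as Fin
open import Data.Fin.Subset using (Subset; ∣_∣)
open import Data.List.Base using (List; []; _∷_; _∷ʳ_; map; length)
open import Data.List.Relation.Unary.Unique.Propositional using (Unique)
open import Data.Nat.Base as ℕ using (ℕ; zero; suc)
import Data.Nat.Properties as ℕ
open import Data.Product.Base using (∃; _×_; _,_; proj₁; proj₂)
open import Data.Rational.Base as ℚ using (ℚ; 0ℚ; 1ℚ; ½; 1/_)
import Data.Rational.Properties as ℚ
import Data.Rational.Solver as ℚ-Solver
open import Data.Vec.Base using (tabulate)
open import Data.Vec.Functional using (Vector)
open import Level using (_⊔_; 0ℓ)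
open import Relation.Binary.Construct.Closure.ReflexiveTransitive using (Star; ε; _◅_)
open import Relation.Binary.PropositionalEquality
  using (_≡_; refl; sym; trans; cong; subst)
open import Relation.Nullary using (¬_; yes; no; does)

-- A real number is a Cauchy sequence of rationals; two of them are equal when
-- their difference tends to zero.
record ℝ : Set where
  no-eta-equality
  field
    seq    : ℕ → ℚ
    cauchy : ∀ δ → 0ℚ ℚ.< δ → ∃ λ N → ∀ m n → N ℕ.≤ m → N ℕ.≤ n →
             ℚ.∣ seq m ℚ.- seq n ∣ ℚ.< δ

open ℝ

infix 4 _≈ʳ_

record _≈ʳ_ (x y : ℝ) : Set where
  no-eta-equality
  constructor mk≈ʳ
  field
    close : ∀ δ → 0ℚ ℚ.< δ → ∃ λ N → ∀ n → N ℕ.≤ n →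
            ℚ.∣ seq x n ℚ.- seq y n ∣ ℚ.< δ

open _≈ʳ_

module _ where
  private
    open ℚ-Solver.+-*-Solver using (solve; _:+_; _:*_; :-_; _:-_; _:=_)

    half-pos : ∀ {δ} → 0ℚ ℚ.< δ → 0ℚ ℚ.< ½ ℚ.* δ
    half-pos {δ} p = subst (ℚ._< ½ ℚ.* δ) (ℚ.*-zeroʳ ½) (ℚ.*-monoʳ-<-pos ½ p)

    half+half : ∀ δ → ½ ℚ.* δ ℚ.+ ½ ℚ.* δ ≡ δ
    half+half δ = trans (sym (ℚ.*-distribʳ-+ δ ½ ½)) (ℚ.*-identityˡ δ)

    ∣p-p∣≡0 : ∀ p → ℚ.∣ p ℚ.- p ∣ ≡ 0ℚ
    ∣p-p∣≡0 p = cong ℚ.∣_∣ (ℚ.+-inverseʳ p)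

    ∣p-q∣≡∣q-p∣ : ∀ p q → ℚ.∣ p ℚ.- q ∣ ≡ ℚ.∣ q ℚ.- p ∣
    ∣p-q∣≡∣q-p∣ p q = trans
      (cong ℚ.∣_∣ (solve 2 (λ p q → p :- q := :- (q :- p)) refl p q))
      (ℚ.∣-p∣≡∣p∣ (q ℚ.- p))

    add< : ∀ {p q δ} → ℚ.∣ p ∣ ℚ.< ½ ℚ.* δ → ℚ.∣ q ∣ ℚ.< ½ ℚ.* δ → ℚ.∣ p ℚ.+ q ∣ ℚ.< δ
    add< {p} {q} {δ} a b = subst (ℚ.∣ p ℚ.+ q ∣ ℚ.<_) (half+half δ)
      (ℚ.≤-<-trans (ℚ.∣p+q∣≤∣p∣+∣q∣ p q) (ℚ.+-mono-< a b))

    trans-close : ∀ {p q r δ} → ℚ.∣ p ℚ.- q ∣ ℚ.< ½ ℚ.* δ → ℚ.∣ q ℚ.- r ∣ ℚ.< ½ ℚ.* δ →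
                  ℚ.∣ p ℚ.- r ∣ ℚ.< δ
    trans-close {p} {q} {r} {δ} a b = subst (λ t → ℚ.∣ t ∣ ℚ.< δ)
      (solve 3 (λ p q r → (p :- q) :+ (q :- r) := p :- r) refl p q r)
      (add< {p ℚ.- q} a b)

    +-close : ∀ {p p′ q q′ δ} → ℚ.∣ p ℚ.- p′ ∣ ℚ.< ½ ℚ.* δ → ℚ.∣ q ℚ.- q′ ∣ ℚ.< ½ ℚ.* δ →
              ℚ.∣ (p ℚ.+ q) ℚ.- (p′ ℚ.+ q′) ∣ ℚ.< δ
    +-close {p} {p′} {q} {q′} {δ} a b = subst (λ t → ℚ.∣ t ∣ ℚ.< δ)
      (solve 4 (λ p p′ q q′ → (p :- p′) :+ (q :- q′) := (p :+ q) :- (p′ :+ q′)) refl p p′ q q′)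
      (add< {p ℚ.- p′} a b)

    neg-close : ∀ {p q δ} → ℚ.∣ p ℚ.- q ∣ ℚ.< δ → ℚ.∣ ℚ.- p ℚ.- ℚ.- q ∣ ℚ.< δ
    neg-close {p} {q} {δ} = subst (ℚ._< δ) (trans (∣p-q∣≡∣q-p∣ p q)
      (cong ℚ.∣_∣ (solve 2 (λ p q → q :- p := :- p :- (:- q)) refl p q)))

    -- The modulus with which factors bounded by C must be close for their
    -- products to be δ-close.
    module Modulus (C : ℚ) (C>0 : 0ℚ ℚ.< C) (δ : ℚ) (δ>0 : 0ℚ ℚ.< δ) where
      private instance
        posC : ℚ.Positive C
        posC = ℚ.positive C>0
        nzC : ℚ.NonZero C
        nzC = ℚ.pos⇒nonZero C
        nnC : ℚ.NonNegative C
        nnC = ℚ.pos⇒nonNeg C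
        pos1/C : ℚ.Positive (1/ C)
        pos1/C = ℚ.1/pos⇒pos C

      η : ℚ
      η = 1/ C ℚ.* (½ ℚ.* δ)

      η>0 : 0ℚ ℚ.< η
      η>0 = subst (ℚ._< η) (ℚ.*-zeroʳ (1/ C)) (ℚ.*-monoʳ-<-pos (1/ C) (half-pos δ>0))

      Cη : C ℚ.* η ≡ ½ ℚ.* δ
      Cη = trans (sym (ℚ.*-assoc C (1/ C) (½ ℚ.* δ)))
        (trans (cong (ℚ._* (½ ℚ.* δ)) (ℚ.*-inverseʳ C)) (ℚ.*-identityˡ _))

      scaled : ∀ p d → ℚ.∣ p ∣ ℚ.< C → ℚ.∣ d ∣ ℚ.< η → ℚ.∣ p ℚ.* d ∣ ℚ.< ½ ℚ.* δ
      scaled p d a b = subst (ℚ._< ½ ℚ.* δ) (sym (ℚ.∣p*q∣≡∣p∣*∣q∣ p d))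
        (ℚ.≤-<-trans
          (ℚ.*-monoʳ-≤-nonNeg ℚ.∣ d ∣ {{ℚ.∣-∣-nonNeg d}} (ℚ.<⇒≤ a))
          (subst (C ℚ.* ℚ.∣ d ∣ ℚ.<_) Cη (ℚ.*-monoʳ-<-pos C b)))

      *-close : ∀ {p p′ q q′} → ℚ.∣ p ∣ ℚ.< C → ℚ.∣ q′ ∣ ℚ.< C →
                ℚ.∣ p ℚ.- p′ ∣ ℚ.< η → ℚ.∣ q ℚ.- q′ ∣ ℚ.< η →
                ℚ.∣ p ℚ.* q ℚ.- p′ ℚ.* q′ ∣ ℚ.< δ
      *-close {p} {p′} {q} {q′} bp bq a b = subst (λ t → ℚ.∣ t ∣ ℚ.< δ)
        (solve 4 (λ p p′ q q′ → p :* (q :- q′) :+ q′ :* (p :- p′) := p :* q :- p′ :* q′)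
          refl p p′ q q′)
        (add< {p ℚ.* (q ℚ.- q′)} (scaled p _ bp b) (scaled q′ _ bq a))

    0<1 : 0ℚ ℚ.< 1ℚ
    0<1 = ℚ.positive⁻¹ 1ℚ

    near⇒bounded : ∀ p q r → ℚ.∣ p ℚ.- q ∣ ℚ.< r → ℚ.∣ p ∣ ℚ.< r ℚ.+ ℚ.∣ q ∣
    near⇒bounded p q r h = subst (λ t → ℚ.∣ t ∣ ℚ.< r ℚ.+ ℚ.∣ q ∣)
      (solve 2 (λ p q → (p :- q) :+ q := p) refl p q)
      (ℚ.≤-<-trans (ℚ.∣p+q∣≤∣p∣+∣q∣ (p ℚ.- q) q) (ℚ.+-monoˡ-< ℚ.∣ q ∣ h))

    widenʳ : ∀ {p C D} → 0ℚ ℚ.< D → p ℚ.< C → p ℚ.< C ℚ.+ D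
    widenʳ {p} {C} {D} D>0 h = subst (ℚ._< C ℚ.+ D) (ℚ.+-identityʳ p) (ℚ.+-mono-< h D>0)

    widenˡ : ∀ {p C D} → 0ℚ ℚ.< C → p ℚ.< D → p ℚ.< C ℚ.+ D
    widenˡ {p} {C} {D} C>0 h = subst (ℚ._< C ℚ.+ D) (ℚ.+-identityˡ p) (ℚ.+-mono-< C>0 h)

    bounded : ∀ x → ∃ λ C → 0ℚ ℚ.< C × ∃ λ N → ∀ n → N ℕ.≤ n → ℚ.∣ seq x n ∣ ℚ.< C
    bounded x =
      let N , f = cauchy x 1ℚ 0<1
      in 1ℚ ℚ.+ ℚ.∣ seq x N ∣
       , ℚ.+-mono-<-≤ {0ℚ} {1ℚ} {0ℚ} {ℚ.∣ seq x N ∣} 0<1 (ℚ.0≤∣p∣ (seq x N))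
       , N
       , λ n N≤n → near⇒bounded (seq x n) (seq x N) 1ℚ (f n N N≤n ℕ.≤-refl)

    bounded₂ : ∀ x y → ∃ λ C → 0ℚ ℚ.< C × ∃ λ N → ∀ n → N ℕ.≤ n →
               ℚ.∣ seq x n ∣ ℚ.< C × ℚ.∣ seq y n ∣ ℚ.< C
    bounded₂ x y =
      let C , C>0 , N , f = bounded x
          D , D>0 , M , g = bounded y
      in C ℚ.+ D , ℚ.+-mono-< {0ℚ} {C} {0ℚ} {D} C>0 D>0 , N ℕ.⊔ M , λ n h →
           widenʳ {ℚ.∣ seq x n ∣} {C} {D} D>0 (f n (ℕ.m⊔n≤o⇒m≤o N M h)) ,
           widenˡ {ℚ.∣ seq y n ∣} {C} {D} C>0 (g n (ℕ.m⊔n≤o⇒n≤o N M h))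

  fromℚ : ℚ → ℝ
  fromℚ p .seq _ = p
  fromℚ p .cauchy δ δ>0 = 0 , λ _ _ _ _ → subst (ℚ._< δ) (sym (∣p-p∣≡0 p)) δ>0

  infixl 6 _+ʳ_
  infixl 7 _*ʳ_
  infix  8 -ʳ_

  _+ʳ_ : ℝ → ℝ → ℝ
  (x +ʳ y) .seq n = seq x n ℚ.+ seq y n
  (x +ʳ y) .cauchy δ δ>0 =
    let N , f = cauchy x (½ ℚ.* δ) (half-pos δ>0)
        M , g = cauchy y (½ ℚ.* δ) (half-pos δ>0)
    in N ℕ.⊔ M , λ m n h k → +-close {seq x m} {seq x n}
         (f m n (ℕ.m⊔n≤o⇒m≤o N M h) (ℕ.m⊔n≤o⇒m≤o N M k))
         (g m n (ℕ.m⊔n≤o⇒n≤o N M h) (ℕ.m⊔n≤o⇒n≤o N M k))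

  -ʳ_ : ℝ → ℝ
  (-ʳ x) .seq n = ℚ.- seq x n
  (-ʳ x) .cauchy δ δ>0 =
    let N , f = cauchy x δ δ>0
    in N , λ m n h k → neg-close {seq x m} (f m n h k)

  _*ʳ_ : ℝ → ℝ → ℝ
  (x *ʳ y) .seq n = seq x n ℚ.* seq y n
  (x *ʳ y) .cauchy δ δ>0 =
    let C , C>0 , K , b = bounded₂ x y
        open Modulus C C>0 δ δ>0
        N , f = cauchy x η η>0
        M , g = cauchy y η η>0
    in K ℕ.⊔ (N ℕ.⊔ M) , λ m n h k →
         let h′ = ℕ.m⊔n≤o⇒n≤o K _ h
             k′ = ℕ.m⊔n≤o⇒n≤o K _ k
         in *-close {seq x m} {seq x n}
              (proj₁ (b m (ℕ.m⊔n≤o⇒m≤o K _ h)))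
              (proj₂ (b n (ℕ.m⊔n≤o⇒m≤o K _ k)))
              (f m n (ℕ.m⊔n≤o⇒m≤o N M h′) (ℕ.m⊔n≤o⇒m≤o N M k′))
              (g m n (ℕ.m⊔n≤o⇒n≤o N M h′) (ℕ.m⊔n≤o⇒n≤o N M k′))

  ≈ʳ-pointwise : ∀ {x y} → (∀ n → seq x n ≡ seq y n) → x ≈ʳ y
  ≈ʳ-pointwise {x} {y} e = mk≈ʳ λ δ δ>0 → 0 , λ n _ →
    subst (ℚ._< δ) (sym (trans (cong (λ t → ℚ.∣ seq x n ℚ.- t ∣) (sym (e n)))
      (∣p-p∣≡0 (seq x n)))) δ>0

  private
    ≈-sym : ∀ {x y} → x ≈ʳ y → y ≈ʳ x
    ≈-sym {x} {y} e = mk≈ʳ λ δ δ>0 →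
      let N , f = close e δ δ>0
      in N , λ n h → subst (ℚ._< δ) (∣p-q∣≡∣q-p∣ (seq x n) (seq y n)) (f n h)

    ≈-trans : ∀ {x y z} → x ≈ʳ y → y ≈ʳ z → x ≈ʳ z
    ≈-trans {x} {y} {z} d e = mk≈ʳ λ δ δ>0 →
      let N , f = close d (½ ℚ.* δ) (half-pos δ>0)
          M , g = close e (½ ℚ.* δ) (half-pos δ>0)
      in N ℕ.⊔ M , λ n h → trans-close {seq x n} {seq y n}
           (f n (ℕ.m⊔n≤o⇒m≤o N M h)) (g n (ℕ.m⊔n≤o⇒n≤o N M h))

    +-cong : ∀ {x x′ y y′} → x ≈ʳ x′ → y ≈ʳ y′ → (x +ʳ y) ≈ʳ (x′ +ʳ y′)
    +-cong {x} {x′} d e = mk≈ʳ λ δ δ>0 →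
      let N , f = close d (½ ℚ.* δ) (half-pos δ>0)
          M , g = close e (½ ℚ.* δ) (half-pos δ>0)
      in N ℕ.⊔ M , λ n h → +-close {seq x n} {seq x′ n}
           (f n (ℕ.m⊔n≤o⇒m≤o N M h)) (g n (ℕ.m⊔n≤o⇒n≤o N M h))

    -‿cong : ∀ {x y} → x ≈ʳ y → (-ʳ x) ≈ʳ (-ʳ y)
    -‿cong {x} e = mk≈ʳ λ δ δ>0 →
      let N , f = close e δ δ>0 in N , λ n h → neg-close {seq x n} (f n h)

    *-cong : ∀ {x x′ y y′} → x ≈ʳ x′ → y ≈ʳ y′ → (x *ʳ y) ≈ʳ (x′ *ʳ y′)
    *-cong {x} {x′} {y} {y′} d e = mk≈ʳ λ δ δ>0 →
      let C , C>0 , K , b = bounded₂ x y′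
          open Modulus C C>0 δ δ>0
          N , f = close d η η>0
          M , g = close e η η>0
      in K ℕ.⊔ (N ℕ.⊔ M) , λ n h →
           let h′ = ℕ.m⊔n≤o⇒n≤o K _ h
               bx , by = b n (ℕ.m⊔n≤o⇒m≤o K _ h)
           in *-close {seq x n} {seq x′ n} bx by
                (f n (ℕ.m⊔n≤o⇒m≤o N M h′)) (g n (ℕ.m⊔n≤o⇒n≤o N M h′))

  ℝ-commutativeRing : CommutativeRing 0ℓ 0ℓ
  ℝ-commutativeRing = record
    { Carrier = ℝ
    ; _≈_ = _≈ʳ_
    ; _+_ = _+ʳ_
    ; _*_ = _*ʳ_
    ; -_ = -ʳ_
    ; 0# = fromℚ 0ℚ
    ; 1# = fromℚ 1ℚ
    ; isCommutativeRing = record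
      { isRing = record
        { +-isAbelianGroup = record
          { isGroup = record
            { isMonoid = record
              { isSemigroup = record
                { isMagma = record
                  { isEquivalence = record
                    { refl = ≈ʳ-pointwise λ _ → refl ; sym = ≈-sym ; trans = ≈-trans }
                  ; ∙-cong = +-cong
                  }
                ; assoc = λ x y z → ≈ʳ-pointwise λ n → ℚ.+-assoc (seq x n) (seq y n) (seq z n)
                }
              ; identity = (λ x → ≈ʳ-pointwise λ n → ℚ.+-identityˡ (seq x n))
                         , (λ x → ≈ʳ-pointwise λ n → ℚ.+-identityʳ (seq x n))
              }
            ; inverse = (λ x → ≈ʳ-pointwise λ n → ℚ.+-inverseˡ (seq x n))
                      , (λ x → ≈ʳ-pointwise λ n → ℚ.+-inverseʳ (seq x n))
            ; ⁻¹-cong = -‿cong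
            }
          ; comm = λ x y → ≈ʳ-pointwise λ n → ℚ.+-comm (seq x n) (seq y n)
          }
        ; *-cong = *-cong
        ; *-assoc = λ x y z → ≈ʳ-pointwise λ n → ℚ.*-assoc (seq x n) (seq y n) (seq z n)
        ; *-identity = (λ x → ≈ʳ-pointwise λ n → ℚ.*-identityˡ (seq x n))
                     , (λ x → ≈ʳ-pointwise λ n → ℚ.*-identityʳ (seq x n))
        ; distrib = (λ x y z → ≈ʳ-pointwise λ n → ℚ.*-distribˡ-+ (seq x n) (seq y n) (seq z n))
                  , (λ x y z → ≈ʳ-pointwise λ n → ℚ.*-distribʳ-+ (seq x n) (seq y n) (seq z n))
        }
      ; *-comm = λ x y → ≈ʳ-pointwise λ n → ℚ.*-comm (seq x n) (seq y n)
      }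
    }

module ℝ-Ring = CommutativeRing ℝ-commutativeRing

private
  module Identities where
    open ℚ-Solver.+-*-Solver using (solve; _:+_; _:*_; :-_; _:=_; con)

    re-assoc : ∀ a b c d e f →
      (a *ʳ c +ʳ -ʳ (b *ʳ d)) *ʳ e +ʳ -ʳ ((a *ʳ d +ʳ b *ʳ c) *ʳ f) ≈ʳ
      a *ʳ (c *ʳ e +ʳ -ʳ (d *ʳ f)) +ʳ -ʳ (b *ʳ (c *ʳ f +ʳ d *ʳ e))
    re-assoc a b c d e f = ≈ʳ-pointwise λ n → solve 6 (λ a b c d e f →
      (a :* c :+ :- (b :* d)) :* e :+ :- ((a :* d :+ b :* c) :* f) :=
      a :* (c :* e :+ :- (d :* f)) :+ :- (b :* (c :* f :+ d :* e)))
      refl (seq a n) (seq b n) (seq c n) (seq d n) (seq e n) (seq f n)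

    im-assoc : ∀ a b c d e f →
      (a *ʳ c +ʳ -ʳ (b *ʳ d)) *ʳ f +ʳ (a *ʳ d +ʳ b *ʳ c) *ʳ e ≈ʳ
      a *ʳ (c *ʳ f +ʳ d *ʳ e) +ʳ b *ʳ (c *ʳ e +ʳ -ʳ (d *ʳ f))
    im-assoc a b c d e f = ≈ʳ-pointwise λ n → solve 6 (λ a b c d e f →
      (a :* c :+ :- (b :* d)) :* f :+ (a :* d :+ b :* c) :* e :=
      a :* (c :* f :+ d :* e) :+ b :* (c :* e :+ :- (d :* f)))
      refl (seq a n) (seq b n) (seq c n) (seq d n) (seq e n) (seq f n)

    re-comm : ∀ a b c d → a *ʳ c +ʳ -ʳ (b *ʳ d) ≈ʳ c *ʳ a +ʳ -ʳ (d *ʳ b)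
    re-comm a b c d = ≈ʳ-pointwise λ n → solve 4 (λ a b c d →
      a :* c :+ :- (b :* d) := c :* a :+ :- (d :* b))
      refl (seq a n) (seq b n) (seq c n) (seq d n)

    im-comm : ∀ a b c d → a *ʳ d +ʳ b *ʳ c ≈ʳ c *ʳ b +ʳ d *ʳ a
    im-comm a b c d = ≈ʳ-pointwise λ n → solve 4 (λ a b c d →
      a :* d :+ b :* c := c :* b :+ d :* a)
      refl (seq a n) (seq b n) (seq c n) (seq d n)

    re-distribʳ : ∀ a b c d e f →
      (c +ʳ e) *ʳ a +ʳ -ʳ ((d +ʳ f) *ʳ b) ≈ʳ
      (c *ʳ a +ʳ -ʳ (d *ʳ b)) +ʳ (e *ʳ a +ʳ -ʳ (f *ʳ b))
    re-distribʳ a b c d e f = ≈ʳ-pointwise λ n → solve 6 (λ a b c d e f →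
      (c :+ e) :* a :+ :- ((d :+ f) :* b) :=
      (c :* a :+ :- (d :* b)) :+ (e :* a :+ :- (f :* b)))
      refl (seq a n) (seq b n) (seq c n) (seq d n) (seq e n) (seq f n)

    im-distribʳ : ∀ a b c d e f →
      (c +ʳ e) *ʳ b +ʳ (d +ʳ f) *ʳ a ≈ʳ (c *ʳ b +ʳ d *ʳ a) +ʳ (e *ʳ b +ʳ f *ʳ a)
    im-distribʳ a b c d e f = ≈ʳ-pointwise λ n → solve 6 (λ a b c d e f →
      (c :+ e) :* b :+ (d :+ f) :* a := (c :* b :+ d :* a) :+ (e :* b :+ f :* a))
      refl (seq a n) (seq b n) (seq c n) (seq d n) (seq e n) (seq f n)

    re-identityˡ : ∀ a b → fromℚ 1ℚ *ʳ a +ʳ -ʳ (fromℚ 0ℚ *ʳ b) ≈ʳ a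
    re-identityˡ a b = ≈ʳ-pointwise λ n → solve 2 (λ a b →
      con 1ℚ :* a :+ :- (con 0ℚ :* b) := a) refl (seq a n) (seq b n)

    im-identityˡ : ∀ a b → fromℚ 1ℚ *ʳ b +ʳ fromℚ 0ℚ *ʳ a ≈ʳ b
    im-identityˡ a b = ≈ʳ-pointwise λ n → solve 2 (λ a b →
      con 1ℚ :* b :+ con 0ℚ :* a := b) refl (seq a n) (seq b n)

    norm-* : ∀ a b c d →
      (a *ʳ c +ʳ -ʳ (b *ʳ d)) *ʳ (a *ʳ c +ʳ -ʳ (b *ʳ d)) +ʳ
      (a *ʳ d +ʳ b *ʳ c) *ʳ (a *ʳ d +ʳ b *ʳ c) ≈ʳ
      (a *ʳ a +ʳ b *ʳ b) *ʳ (c *ʳ c +ʳ d *ʳ d)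
    norm-* a b c d = ≈ʳ-pointwise λ n → solve 4 (λ a b c d →
      (a :* c :+ :- (b :* d)) :* (a :* c :+ :- (b :* d)) :+
      (a :* d :+ b :* c) :* (a :* d :+ b :* c) :=
      (a :* a :+ b :* b) :* (c :* c :+ d :* d))
      refl (seq a n) (seq b n) (seq c n) (seq d n)

    norm-conj : ∀ a b → a *ʳ a +ʳ (-ʳ b) *ʳ (-ʳ b) ≈ʳ a *ʳ a +ʳ b *ʳ b
    norm-conj a b = ≈ʳ-pointwise λ n → solve 2 (λ a b →
      a :* a :+ (:- b) :* (:- b) := a :* a :+ b :* b) refl (seq a n) (seq b n)

    norm-1 : fromℚ 1ℚ *ʳ fromℚ 1ℚ +ʳ fromℚ 0ℚ *ʳ fromℚ 0ℚ ≈ʳ fromℚ 1ℚ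
    norm-1 = ≈ʳ-pointwise λ _ → refl

record ℂ : Set where
  no-eta-equality
  field
    re im : ℝ

open ℂ

infix 4 _≈ᶜ_

record _≈ᶜ_ (z w : ℂ) : Set where
  no-eta-equality
  constructor mk≈ᶜ
  field
    re-≈ : re z ≈ʳ re w
    im-≈ : im z ≈ʳ im w

open _≈ᶜ_

infixl 6 _+ᶜ_
infixl 7 _*ᶜ_
infix  8 -ᶜ_

0ᶜ 1ᶜ : ℂ
0ᶜ .re = fromℚ 0ℚ
0ᶜ .im = fromℚ 0ℚ
1ᶜ .re = fromℚ 1ℚ
1ᶜ .im = fromℚ 0ℚ

_+ᶜ_ : ℂ → ℂ → ℂ
(z +ᶜ w) .re = re z +ʳ re w
(z +ᶜ w) .im = im z +ʳ im w

-ᶜ_ : ℂ → ℂ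
(-ᶜ z) .re = -ʳ re z
(-ᶜ z) .im = -ʳ im z

_*ᶜ_ : ℂ → ℂ → ℂ
(z *ᶜ w) .re = re z *ʳ re w +ʳ -ʳ (im z *ʳ im w)
(z *ᶜ w) .im = re z *ʳ im w +ʳ im z *ʳ re w

conj : ℂ → ℂ
conj z .re = re z
conj z .im = -ʳ im z

∣_∣² : ℂ → ℝ
∣ z ∣² = re z *ʳ re z +ʳ im z *ʳ im z

ℂ-commutativeRing : CommutativeRing 0ℓ 0ℓ
ℂ-commutativeRing = record
  { Carrier = ℂ
  ; _≈_ = _≈ᶜ_
  ; _+_ = _+ᶜ_
  ; _*_ = _*ᶜ_
  ; -_ = -ᶜ_
  ; 0# = 0ᶜ
  ; 1# = 1ᶜ
  ; isCommutativeRing = record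
    { isRing = record
      { +-isAbelianGroup = record
        { isGroup = record
          { isMonoid = record
            { isSemigroup = record
              { isMagma = record
                { isEquivalence = record
                  { refl  = mk≈ᶜ R.refl R.refl
                  ; sym   = λ p → mk≈ᶜ (R.sym (re-≈ p)) (R.sym (im-≈ p))
                  ; trans = λ p q → mk≈ᶜ (R.trans (re-≈ p) (re-≈ q)) (R.trans (im-≈ p) (im-≈ q))
                  }
                ; ∙-cong = λ p q → mk≈ᶜ (R.+-cong (re-≈ p) (re-≈ q)) (R.+-cong (im-≈ p) (im-≈ q))
                }
              ; assoc = λ x y z → mk≈ᶜ (R.+-assoc (re x) (re y) (re z)) (R.+-assoc (im x) (im y) (im z))
              }
            ; identity = (λ z → mk≈ᶜ (R.+-identityˡ (re z)) (R.+-identityˡ (im z)))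
                       , (λ z → mk≈ᶜ (R.+-identityʳ (re z)) (R.+-identityʳ (im z)))
            }
          ; inverse = (λ z → mk≈ᶜ (R.-‿inverseˡ (re z)) (R.-‿inverseˡ (im z)))
                    , (λ z → mk≈ᶜ (R.-‿inverseʳ (re z)) (R.-‿inverseʳ (im z)))
          ; ⁻¹-cong = λ p → mk≈ᶜ (R.-‿cong (re-≈ p)) (R.-‿cong (im-≈ p))
          }
        ; comm = λ z w → mk≈ᶜ (R.+-comm (re z) (re w)) (R.+-comm (im z) (im w))
        }
      ; *-cong = λ p q → mk≈ᶜ
          (R.+-cong (R.*-cong (re-≈ p) (re-≈ q)) (R.-‿cong (R.*-cong (im-≈ p) (im-≈ q))))
          (R.+-cong (R.*-cong (re-≈ p) (im-≈ q)) (R.*-cong (im-≈ p) (re-≈ q)))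
      ; *-assoc = λ x y z → mk≈ᶜ
          (re-assoc (re x) (im x) (re y) (im y) (re z) (im z))
          (im-assoc (re x) (im x) (re y) (im y) (re z) (im z))
      ; *-identity = identityˡ
                   , λ z → ≈-trans (*-comm z 1ᶜ) (identityˡ z)
      ; distrib = (λ x y z → ≈-trans (*-comm x (y +ᶜ z)) (≈-trans (distribʳ x y z)
                    (mk≈ᶜ (R.+-cong (re-≈ (*-comm y x)) (re-≈ (*-comm z x)))
                          (R.+-cong (im-≈ (*-comm y x)) (im-≈ (*-comm z x))))))
                , distribʳ
      }
    ; *-comm = *-comm
    }
  }
  where
  module R = ℝ-Ring
  open Identities
  ≈-trans : ∀ {x y z} → x ≈ᶜ y → y ≈ᶜ z → x ≈ᶜ z
  ≈-trans p q = mk≈ᶜ (R.trans (re-≈ p) (re-≈ q)) (R.trans (im-≈ p) (im-≈ q))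
  *-comm : ∀ z w → z *ᶜ w ≈ᶜ w *ᶜ z
  *-comm z w = mk≈ᶜ (re-comm (re z) (im z) (re w) (im w)) (im-comm (re z) (im z) (re w) (im w))
  identityˡ : ∀ z → 1ᶜ *ᶜ z ≈ᶜ z
  identityˡ z = mk≈ᶜ (re-identityˡ (re z) (im z)) (im-identityˡ (re z) (im z))
  distribʳ : ∀ x y z → (y +ᶜ z) *ᶜ x ≈ᶜ y *ᶜ x +ᶜ z *ᶜ x
  distribʳ x y z = mk≈ᶜ
    (re-distribʳ (re x) (im x) (re y) (im y) (re z) (im z))
    (im-distribʳ (re x) (im x) (re y) (im y) (re z) (im z))

module ℂ-Ring = CommutativeRing ℂ-commutativeRing

-- The circle group.  ∣ z ∣ = 1 is expressed as ∣ z ∣² = 1, which avoids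
-- a square root.
record 𝕋 : Set where
  no-eta-equality
  field
    val  : ℂ
    unit : ∣ val ∣² ≈ʳ fromℚ 1ℚ

open 𝕋 public using (val)
open 𝕋 using (unit)

infixl 7 _·_

1ᵗ : 𝕋
1ᵗ .val  = 1ᶜ
1ᵗ .unit = Identities.norm-1

_·_ : 𝕋 → 𝕋 → 𝕋
(z · w) .val  = val z *ᶜ val w
(z · w) .unit = ℝ-Ring.trans
  (Identities.norm-* (re (val z)) (im (val z)) (re (val w)) (im (val w)))
  (ℝ-Ring.trans (ℝ-Ring.*-cong (unit z) (unit w)) (ℝ-Ring.*-identityˡ (fromℚ 1ℚ)))

conjᵗ : 𝕋 → 𝕋
conjᵗ z .val  = conj (val z)
conjᵗ z .unit = ℝ-Ring.trans
  (Identities.norm-conj (re (val z)) (im (val z))) (unit z)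

Matrix : ∀ {a} → Set a → ℕ → Set a
Matrix A n = Vector (Vector A n) n

module LinearAlgebra {c ℓ} (R : RawRing c ℓ) where
  open RawRing R
  open import Algebra.Definitions.RawSemiring rawSemiring using (_^_)
  open RawMonoidDefinitions +-rawMonoid using (sum)

  diag : ∀ {n} → Vector Carrier n → Matrix Carrier n
  diag d i j = if does (i Fin.≟ j) then d i else 0#

  -- Laplace expansion along the first row.
  det : ∀ {n} → Matrix Carrier n → Carrier
  det {zero}  M = 1#
  det {suc n} M =
    sum λ j → (- 1#) ^ toℕ j * M zero j * det λ i k → M (suc i) (punchIn j k)

  infixl 7 _*ᵥ_

  _*ᵥ_ : ∀ {n} → Matrix Carrier n → Vector Carrier n → Vector Carrier n
  (M *ᵥ x) i = sum λ j → M i j * x j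

  -- x ≠ 0 is the negation of x = 0; no coordinate is exhibited as apart
  -- from zero.
  IsEigenvalue : ∀ {n} → Carrier → Matrix Carrier n → Set (c ⊔ ℓ)
  IsEigenvalue {n} μ M = ∃ λ (x : Vector Carrier n) →
    ¬ (∀ i → x i ≈ 0#) × (∀ i → (M *ᵥ x) i ≈ μ * x i)

-- A polynomial is its list of coefficients, constant term first; trailing
-- zeros are immaterial.
module Polynomial {c ℓ} (R : RawRing c ℓ) where
  open RawRing R

  Poly : Set c
  Poly = List Carrier

  coeff : Poly → ℕ → Carrier
  coeff []      k       = 0#
  coeff (a ∷ p) zero    = a
  coeff (a ∷ p) (suc k) = coeff p k

  addP : Poly → Poly → Poly
  addP []      q       = q
  addP (a ∷ p) []      = a ∷ p
  addP (a ∷ p) (b ∷ q) = (a + b) ∷ addP p q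

  mulP : Poly → Poly → Poly
  mulP []      q = []
  mulP (a ∷ p) q = addP (map (a *_) q) (0# ∷ mulP p q)

  constant : Carrier → Poly
  constant a = a ∷ []

  X : Poly
  X = 0# ∷ 1# ∷ []

  polyRawRing : RawRing c ℓ
  polyRawRing = record
    { Carrier = Poly
    ; _≈_     = λ p q → ∀ k → coeff p k ≈ coeff q k
    ; _+_     = addP
    ; _*_     = mulP
    ; -_      = map -_
    ; 0#      = []
    ; 1#      = constant 1#
    }

module CharacteristicPolynomial {c ℓ} (R : RawRing c ℓ) where
  open RawRing R using (Carrier)
  open Polynomial R
  open RawRing polyRawRing using (_≈_; _+_; -_)
  open LinearAlgebra polyRawRing using (det; diag)

  charPoly : ∀ {n} → Matrix Carrier n → Poly
  charPoly M = det λ i j → diag (λ _ → X) i j + - constant (M i j)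

  Cospectral : ∀ {n} → Matrix Carrier n → Matrix Carrier n → Set ℓ
  Cospectral M N = charPoly M ≈ charPoly N

open LinearAlgebra ℂ-Ring.rawRing public using (diag; IsEigenvalue)
open CharacteristicPolynomial ℂ-Ring.rawRing public using (Cospectral)

record Digraph (n : ℕ) : Set where
  field
    arc      : Fin n → Fin n → Bool
    loopless : ∀ i → ¬ T (arc i i)

  Arc : Fin n → Fin n → Set
  Arc i j = T (arc i j)

  deg⁺ : Fin n → ℕ
  deg⁺ i = ∣ outNeighbours ∣
    where
    outNeighbours : Subset n
    outNeighbours = tabulate (arc i)

  Walk : Fin n → Fin n → Set
  Walk = Star Arc

  -- The starting vertices of the arcs of a walk, i.e. all of its vertices
  -- but the last.
  sources : ∀ {i j} → Walk i j → List (Fin n)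
  sources ε               = []
  sources (_◅_ {i} _ w) = i ∷ sources w

  IsPath : ∀ {i j} → Walk i j → Set
  IsPath {j = j} w = Unique (sources w ∷ʳ j)

  -- Looplessness makes the length at least 2.
  IsCycle : ∀ {i} → Walk i i → Set
  IsCycle c = 1 ℕ.≤ length (sources c) × Unique (sources c)

  StronglyConnected : Set
  StronglyConnected = ∀ i j → ∃ λ (w : Walk i j) → IsPath w

  adjacency : Matrix ℂ n
  adjacency i j = if arc i j then 1ᶜ else 0ᶜ

  outDegrees : Matrix ℂ n
  outDegrees = diag λ i → deg⁺ i ×ᶜ 1ᶜ
    where open RawMonoidDefinitions ℂ-Ring.+-rawMonoid renaming (_×_ to _×ᶜ_)

  laplacian : Matrix ℂ n
  laplacian i j = outDegrees i j +ᶜ -ᶜ adjacency i j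

open Digraph public using (StronglyConnected)

record GainDigraph {n} (D : Digraph n) : Set where
  open Digraph D
  field
    gain : ∀ i j → Arc i j → 𝕋

  walkGain : ∀ {i j} → Walk i j → 𝕋
  walkGain ε                     = 1ᵗ
  walkGain (_◅_ {i} {j} a w) = gain i j a · walkGain w

  CycleBalanced : Set
  CycleBalanced = ∀ {i} (c : Walk i i) → IsCycle c → val (walkGain c) ≈ᶜ 1ᶜ

  gainAdjacency : Matrix ℂ n
  gainAdjacency i j with T? (arc i j)
  ... | yes a = val (gain i j a)
  ... | no  _ = 0ᶜ

  gainLaplacian : Matrix ℂ n
  gainLaplacian i j = outDegrees i j +ᶜ -ᶜ gainAdjacency i j

  switch : (Fin n → 𝕋) → GainDigraph D
  switch σ = record { gain = λ i j a → σ i · gain i j a · conjᵗ (σ j) }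

  HasPotential : Set
  HasPotential = ∃ λ (ψ : Fin n → 𝕋) → ∀ i j (a : Arc i j) →
    val (gain i j a) ≈ᶜ val (conjᵗ (ψ i) · ψ j)

open GainDigraph public
  using (CycleBalanced; HasPotential; gainLaplacian; switch)

infix 4 _∼_

_∼_ : ∀ {n} {D : Digraph n} → GainDigraph D → GainDigraph D → Set
_∼_ {n} {D} Φ Φ′ = ∃ λ (σ : Fin n → 𝕋) → ∀ i j (a : Digraph.Arc D i j) →
  val (GainDigraph.gain Φ′ i j a) ≈ᶜ val (GainDigraph.gain (switch Φ σ) i j a)

allOnes : ∀ {n} (D : Digraph n) → GainDigraph D
allOnes D = record { gain = λ _ _ _ → 1ᵗ }

open Digraph public using (laplacian)

{-# OPTIONS --safe #-}

-- If L(Φ) x = 0 and |x i| is maximal, then x i is the average of the numbers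
-- φ(i , j) x j over the out-neighbours j, none of which is longer than x i, so
-- all of them equal x i.  Strong connectedness spreads this to every vertex:
-- x i = φ(w) x j for every walk w from i to j, and x has no zero entry, so every
-- closed walk has gain 1.  Cospectrality of L(Φ) and L(D) gives
-- det (- L(Φ)) = det (- L(D)) = 0 (constant coefficients), hence such an x.
-- Conversely, when every cycle has gain 1, erasing loops shows that the gains of
-- walks from a root form a potential ψ; then L(Φ) is diagonally similar to L(D),
-- and conj ψ lies in its kernel.
--
-- Choosing a vertex of maximal modulus or a pivot requires deciding equality and
-- order of real numbers.  These choices are made under a double negation, which is
-- harmless because the conclusion, an equation between complex numbers, is stable.
module Submission where

open import Defs
open import Data.Nat.Base using (ℕ; NonZero)
open import Data.Product.Base using (_×_)
open import Function.Bundles using (_⇔_)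

import Algebra.Definitions.RawMonoid as RawMonoidDefinitions
import Algebra.Properties.CommutativeMonoid.Sum as CommutativeMonoidSum
import Algebra.Properties.Ring as RingProperties
import Algebra.Properties.Semiring.Sum as SemiringSum
open import Algebra.Bundles using (RawRing; CommutativeRing)
open import Data.Bool.Base using (Bool; true; false; T; if_then_else_)
open import Data.Bool.Properties using (T?; T-irrelevant)
open import Data.Empty using (⊥; ⊥-elim)
open import Data.Fin.Base using (Fin; zero; suc; toℕ; punchIn; punchOut; inject₁)
open import Data.Fin.Permutation using (permutation)
import Data.Fin.Properties as Fin
open import Data.Fin.Subset using (∣_∣)
open import Data.List.Base using ([]; _∷_; _∷ʳ_; map; drop)
open import Data.List.Membership.Propositional using (_∈_)
open import Data.List.Membership.Propositional.Properties using (∈-++⁺ʳ)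
open import Data.List.Relation.Unary.All as All using ([]; _∷_)
open import Data.List.Relation.Unary.AllPairs using ([]; _∷_)
open import Data.List.Relation.Unary.Any using (here; there)
open import Data.List.Relation.Unary.Unique.Propositional using (Unique)
open import Data.Nat.Base as ℕ using (zero; suc; s≤s; z≤n)
import Data.Nat.Properties as ℕ
open import Data.Product.Base using (∃; _,_; proj₁)
open import Data.Rational.Base as ℚ using (ℚ; 0ℚ; 1ℚ; ½)
import Data.Rational.Properties as ℚ
import Data.Rational.Solver as ℚ-Solver
open import Data.Sum.Base using (_⊎_; inj₁; inj₂)
open import Data.Vec.Base using (tabulate)
open import Data.Vec.Functional using (Vector; insertAt)
import Data.Vec.Functional.Properties as Vector
open import Function.Base using (_∘_)
open import Function.Bundles using (mk⇔)
open import Level using (_⊔_)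
open import Relation.Binary.Construct.Closure.ReflexiveTransitive using (ε; _◅_; _◅◅_)
open import Relation.Binary.Definitions using (tri<; tri≈; tri>)
open import Relation.Binary.PropositionalEquality as ≡ using (_≡_; _≢_)
import Relation.Binary.Reasoning.Setoid as SetoidReasoning
open import Relation.Nullary using (¬_; Dec; yes; no; contradiction; ¬¬-excluded-middle)
open import Relation.Nullary.Decidable using (from-no)

-- Determinants and kernels

-- Excluded middle is available under a double negation for one proposition at a time, and a finite
-- index set requires it only finitely often. It serves to find a pivot in elimination.
¬¬-all-or-counterexample : ∀ {p n} (P : Fin n → Set p) →
  ¬ ¬ ((∀ i → P i) ⊎ ∃ λ i → ¬ P i)
¬¬-all-or-counterexample {n = zero}  P k = k (inj₁ λ ())
¬¬-all-or-counterexample {n = suc n} P k = ¬¬-excluded-middle λ where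
  (no ¬p) → k (inj₂ (zero , ¬p))
  (yes p) → ¬¬-all-or-counterexample (P ∘ suc) λ where
    (inj₁ ps)       → k (inj₁ λ { zero → p ; (suc i) → ps i })
    (inj₂ (i , ¬p)) → k (inj₂ (suc i , ¬p))

-- Transpositions of the neighbouring columns `inject₁ k` and `suc k`

swapAdjacent : ∀ {n} → Fin n → Fin (suc n) → Fin (suc n)
swapAdjacent zero    zero          = suc zero
swapAdjacent zero    (suc zero)    = zero
swapAdjacent zero    (suc (suc j)) = suc (suc j)
swapAdjacent (suc k) zero          = zero
swapAdjacent (suc k) (suc j)       = suc (swapAdjacent k j)

-- How deleting column j interacts with the transposition of columns k and k+1.
data SwapView : ∀ {n} → Fin n → Fin (suc n) → Set where
  up    : ∀ {n} {k : Fin n} {j} → toℕ (swapAdjacent k j) ≡ suc (toℕ j) →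
          (∀ l → swapAdjacent k (punchIn j l) ≡ punchIn (swapAdjacent k j) l) → SwapView k j
  down  : ∀ {n} {k : Fin n} {j} → toℕ j ≡ suc (toℕ (swapAdjacent k j)) →
          (∀ l → swapAdjacent k (punchIn j l) ≡ punchIn (swapAdjacent k j) l) → SwapView k j
  fixed : ∀ {n} {k : Fin (suc n)} {j} → swapAdjacent k j ≡ j → (k′ : Fin n) →
          (∀ l → swapAdjacent k (punchIn j l) ≡ punchIn j (swapAdjacent k′ l)) → SwapView k j

swapView : ∀ {n} (k : Fin n) j → SwapView k j
swapView zero          zero          = up ≡.refl λ { zero → ≡.refl ; (suc l) → ≡.refl }
swapView zero          (suc zero)    = down ≡.refl λ { zero → ≡.refl ; (suc l) → ≡.refl }
swapView {suc (suc n)} zero (suc (suc j)) = fixed ≡.refl zero λ where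
  zero          → ≡.refl
  (suc zero)    → ≡.refl
  (suc (suc l)) → ≡.refl
swapView {suc (suc n)} (suc k) zero  = fixed ≡.refl k λ l → ≡.refl
swapView (suc k)       (suc j) with swapView k j
... | up e f       = up (≡.cong suc e) λ { zero → ≡.refl ; (suc l) → ≡.cong suc (f l) }
... | down e f     = down (≡.cong suc e) λ { zero → ≡.refl ; (suc l) → ≡.cong suc (f l) }
... | fixed e k′ f = fixed (≡.cong suc e) (suc k′)
  λ { zero → ≡.refl ; (suc l) → ≡.cong suc (f l) }

swapAdjacent-involutive : ∀ {n} (k : Fin n) j → swapAdjacent k (swapAdjacent k j) ≡ j
swapAdjacent-involutive zero    zero          = ≡.refl
swapAdjacent-involutive zero    (suc zero)    = ≡.refl
swapAdjacent-involutive zero    (suc (suc j)) = ≡.refl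
swapAdjacent-involutive (suc k) zero          = ≡.refl
swapAdjacent-involutive (suc k) (suc j)       = ≡.cong suc (swapAdjacent-involutive k j)

swapAdjacent-inject₁ : ∀ {n} (k : Fin n) → swapAdjacent k (inject₁ k) ≡ suc k
swapAdjacent-inject₁ zero    = ≡.refl
swapAdjacent-inject₁ (suc k) = ≡.cong suc (swapAdjacent-inject₁ k)

swapAdjacent-suc : ∀ {n} (k : Fin n) → swapAdjacent k (suc k) ≡ inject₁ k
swapAdjacent-suc zero    = ≡.refl
swapAdjacent-suc (suc k) = ≡.cong suc (swapAdjacent-suc k)

swapAdjacent-other : ∀ {n} (k : Fin n) j → j ≢ inject₁ k → j ≢ suc k → swapAdjacent k j ≡ j
swapAdjacent-other zero    zero          p q = contradiction ≡.refl p
swapAdjacent-other zero    (suc zero)    p q = contradiction ≡.refl q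
swapAdjacent-other zero    (suc (suc j)) p q = ≡.refl
swapAdjacent-other (suc k) zero          p q = ≡.refl
swapAdjacent-other (suc k) (suc j)       p q =
  ≡.cong suc (swapAdjacent-other k j (p ∘ ≡.cong suc) (q ∘ ≡.cong suc))

module Determinants {c ℓ} (R : CommutativeRing c ℓ) where
  open CommutativeRing R hiding (zero)
  open LinearAlgebra rawRing using (det; _*ᵥ_)
  open import Algebra.Definitions.RawSemiring (RawRing.rawSemiring rawRing) using (_^_)
  open RingProperties ring using (-‿distribˡ-*; -‿distribʳ-*; -1*x≈-x; -‿involutive; -0#≈0#; -‿+-comm)
  open SemiringSum semiring
    using (sum; sum-cong-≋; sum-remove; sum-replicate-zero; sum-permute; ∑-distrib-+; ∑-comm;
           *-distribˡ-sum; *-distribʳ-sum)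
  open SetoidReasoning setoid
  open import Algebra.Solver.Ring.NaturalCoefficients.Default commutativeSemiring
    using (solve; _:+_; _:*_; _:=_)

  sum-zero : ∀ {n} {f : Vector Carrier n} → (∀ i → f i ≈ 0#) → sum f ≈ 0#
  sum-zero {n} h = trans (sum-cong-≋ h) (sum-replicate-zero n)

  sum-single : ∀ {n} (f : Vector Carrier n) k → (∀ i → i ≢ k → f i ≈ 0#) → sum f ≈ f k
  sum-single {suc n} f k h = begin
    sum f                        ≈⟨ sum-remove {i = k} f ⟩
    f k + sum (f ∘ punchIn k)    ≈⟨ +-congˡ (sum-zero λ i → h (punchIn k i) (Fin.punchInᵢ≢i k i)) ⟩
    f k + 0#                     ≈⟨ +-identityʳ (f k) ⟩
    f k                          ∎

  sum-neg : ∀ {n} (f : Vector Carrier n) → sum (λ i → - f i) ≈ - sum f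
  sum-neg {zero}  f = sym -0#≈0#
  sum-neg {suc n} f = trans (+-congˡ (sum-neg (f ∘ suc))) (-‿+-comm _ _)

  minor : ∀ {n} → Matrix Carrier (suc n) → Fin (suc n) → Matrix Carrier n
  minor M j i k = M (suc i) (punchIn j k)

  laplaceTerm : ∀ {n} → Matrix Carrier (suc n) → Fin (suc n) → Carrier
  laplaceTerm M j = (- 1#) ^ toℕ j * M zero j * det (minor M j)

  det-cong : ∀ {n} {M N : Matrix Carrier n} → (∀ i j → M i j ≈ N i j) → det M ≈ det N
  det-cong {zero}  h = refl
  det-cong {suc n} h = sum-cong-≋ λ j →
    *-cong (*-congˡ {(- 1#) ^ toℕ j} (h zero j)) (det-cong λ i k → h (suc i) (punchIn j k))

  det-≡ : ∀ {n} {M N : Matrix Carrier n} → (∀ i j → M i j ≡ N i j) → det M ≈ det N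
  det-≡ h = det-cong λ i j → reflexive (h i j)

  ^-suc : ∀ m {k} → m ≡ suc k → (- 1#) ^ m ≈ - (- 1#) ^ k
  ^-suc m ≡.refl = -1*x≈-x _

  -- Reindex the Laplace expansion by the transposition. A term at one of the two swapped columns
  -- keeps its minor, but its position moves by one and the sign flips. At any other column the sign
  -- stays and the minor has two neighbouring columns swapped, so induction applies.
  det-swap : ∀ {n} (M : Matrix Carrier (suc n)) k →
    det (λ i j → M i (swapAdjacent k j)) ≈ - det M
  det-swap {suc n} M k = begin
    sum (laplaceTerm M′)                      ≈⟨ sum-cong-≋ term ⟩
    sum (λ j → - laplaceTerm M (σ j))         ≈⟨ sum-neg (laplaceTerm M ∘ σ) ⟩
    - sum (laplaceTerm M ∘ σ)                 ≈⟨ -‿cong (sym (sum-permute (laplaceTerm M)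
      (permutation σ σ (swapAdjacent-involutive k) (swapAdjacent-involutive k)))) ⟩
    - det M                                   ∎
    where
    σ = swapAdjacent k
    M′ : Matrix Carrier (suc (suc n))
    M′ i j = M i (σ j)

    negate : ∀ {s t a d e} → s ≈ - t → d ≈ e → s * a * d ≈ - (t * a * e)
    negate {s} {t} {a} {d} {e} p q = begin
      s * a * d       ≈⟨ *-cong (*-congʳ p) q ⟩
      - t * a * e     ≈⟨ *-congʳ (sym (-‿distribˡ-* t a)) ⟩
      - (t * a) * e   ≈⟨ sym (-‿distribˡ-* (t * a) e) ⟩
      - (t * a * e)   ∎

    term : ∀ j → laplaceTerm M′ j ≈ - laplaceTerm M (σ j)
    term j with swapView k j
    ... | up e f = negate
      (trans (sym (-‿involutive _)) (-‿cong (sym (^-suc _ e))))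
      (det-≡ λ i l → ≡.cong (M (suc i)) (f l))
    ... | down e f = negate (^-suc _ e) (det-≡ λ i l → ≡.cong (M (suc i)) (f l))
    ... | fixed e k′ f = begin
      (- 1#) ^ toℕ j * M zero (σ j) * det (minor M′ j)
        ≈⟨ *-congˡ (trans (det-≡ λ i l → ≡.cong (M (suc i)) (f l)) (det-swap (minor M j) k′)) ⟩
      (- 1#) ^ toℕ j * M zero (σ j) * - det (minor M j)
        ≈⟨ sym (-‿distribʳ-* _ _) ⟩
      - ((- 1#) ^ toℕ j * M zero (σ j) * det (minor M j))
        ≡⟨ ≡.cong (λ t → - ((- 1#) ^ toℕ t * M zero (σ j) * det (minor M t))) e ⟨
      - laplaceTerm M (σ j) ∎

  -- The matrices P l agree with N off column k, and column k of N is the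
  -- combination of theirs with coefficients x.  A zero column is the case m = 0.
  det-linear-column : ∀ {n m} (N : Matrix Carrier n) (P : Fin m → Matrix Carrier n)
    (x : Vector Carrier m) k →
    (∀ l i j → j ≢ k → P l i j ≈ N i j) →
    (∀ i → N i k ≈ sum λ l → x l * P l i k) →
    det N ≈ sum λ l → x l * det (P l)
  det-linear-column {suc n} {m} N P x k same comb = begin
    sum (laplaceTerm N)                            ≈⟨ sum-cong-≋ term ⟩
    sum (λ j → sum λ l → x l * laplaceTerm (P l) j) ≈⟨ ∑-comm (λ j l → x l * laplaceTerm (P l) j) ⟩
    sum (λ l → sum λ j → x l * laplaceTerm (P l) j)
      ≈⟨ sum-cong-≋ (λ l → sym (*-distribˡ-sum (x l) (laplaceTerm (P l)))) ⟩
    sum (λ l → x l * det (P l))                    ∎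
    where
    term : ∀ j → laplaceTerm N j ≈ sum λ l → x l * laplaceTerm (P l) j
    term j with j Fin.≟ k
    ... | yes ≡.refl = begin
      s * N zero k * d                          ≈⟨ *-congʳ (*-congˡ (comb zero)) ⟩
      s * sum (λ l → x l * P l zero k) * d
        ≈⟨ *-congʳ (*-distribˡ-sum s (λ l → x l * P l zero k)) ⟩
      sum (λ l → s * (x l * P l zero k)) * d    ≈⟨ *-distribʳ-sum d (λ l → s * (x l * P l zero k)) ⟩
      sum (λ l → s * (x l * P l zero k) * d)    ≈⟨ sum-cong-≋ (λ l → trans
        (solve 4 (λ s x p d → s :* (x :* p) :* d := x :* (s :* p :* d)) refl s (x l) (P l zero k) d)
        (*-congˡ (*-congˡ (det-cong λ i i′ → sym (same l (suc i) _ (Fin.punchInᵢ≢i k i′)))))) ⟩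
      sum (λ l → x l * laplaceTerm (P l) k)     ∎
      where
      s = (- 1#) ^ toℕ k
      d = det (minor N k)
    -- Column `k` survives in this minor at position `punchOut j≢k`, so the induction hypothesis
    -- splits the minor, while the entry `N zero j` is common to all `P l`.
    ... | no j≢k = begin
      s * N zero j * det (minor N j)
        ≈⟨ *-congˡ (det-linear-column (minor N j) (λ l → minor (P l) j) x (punchOut j≢k)
             (λ l i i′ i′≢ → same l (suc i) _ λ e → i′≢
               (Fin.punchIn-injective j i′ _ (≡.trans e (≡.sym (Fin.punchIn-punchOut j≢k)))))
             (λ i → ≡.subst (λ t → N (suc i) t ≈ sum λ l → x l * P l (suc i) t)
               (≡.sym (Fin.punchIn-punchOut j≢k)) (comb (suc i)))) ⟩
      s * N zero j * sum (λ l → x l * det (minor (P l) j))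
        ≈⟨ *-distribˡ-sum (s * N zero j) (λ l → x l * det (minor (P l) j)) ⟩
      sum (λ l → s * N zero j * (x l * det (minor (P l) j)))
        ≈⟨ sum-cong-≋ (λ l → trans
             (solve 4 (λ s a x d → s :* a :* (x :* d) := x :* (s :* a :* d)) refl s (N zero j) (x l) (det (minor (P l) j)))
             (*-congˡ (*-congʳ (*-congˡ (sym (same l zero j j≢k)))))) ⟩
      sum (λ l → x l * laplaceTerm (P l) j) ∎
      where
      s = (- 1#) ^ toℕ j

  det-zero-column : ∀ {n} (M : Matrix Carrier n) k → (∀ i → M i k ≈ 0#) → det M ≈ 0#
  det-zero-column M k h = det-linear-column {m = 0} M (λ ()) (λ ()) k (λ ()) h

  -- Every minor taken at a column other than `k` still contains the lower part of column `k`, which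
  -- is zero.
  det-unit-column : ∀ {n} (M : Matrix Carrier (suc n)) k → (∀ i → M (suc i) k ≈ 0#) →
    det M ≈ laplaceTerm M k
  det-unit-column M k h = sum-single (laplaceTerm M) k λ j j≢k → trans
    (*-congˡ (det-zero-column (minor M j) (punchOut j≢k) λ i →
      trans (reflexive (≡.cong (M (suc i)) (Fin.punchIn-punchOut j≢k))) (h i)))
    (zeroʳ _)

  replaceColumn : ∀ {n} → Fin n → Vector Carrier n → Matrix Carrier n → Matrix Carrier n
  replaceColumn k v M i j with j Fin.≟ k
  ... | yes _ = v i
  ... | no  _ = M i j

  replaceColumn-at : ∀ {n} k v (M : Matrix Carrier n) i → replaceColumn k v M i k ≡ v i
  replaceColumn-at k v M i with k Fin.≟ k
  ... | yes _  = ≡.refl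
  ... | no k≢k = contradiction ≡.refl k≢k

  replaceColumn-off : ∀ {n} k v (M : Matrix Carrier n) i {j} → j ≢ k →
    replaceColumn k v M i j ≡ M i j
  replaceColumn-off k v M i {j} j≢k with j Fin.≟ k
  ... | yes j≡k = contradiction j≡k j≢k
  ... | no  _   = ≡.refl

  -- An integral domain in which 2 is nonzero: `2≉0` turns antisymmetry of `det` into vanishing on
  -- equal columns, and `cancel` replaces division.
  module Domain
    (1≉0    : ¬ 1# ≈ 0#)
    (2≉0    : ¬ 1# + 1# ≈ 0#)
    (cancel : ∀ {x y} → ¬ x ≈ 0# → x * y ≈ 0# → y ≈ 0#)
    where

    self-negative : ∀ {x} → x ≈ - x → x ≈ 0#
    self-negative {x} h = cancel 2≉0 (begin
      (1# + 1#) * x     ≈⟨ distribʳ x 1# 1# ⟩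
      1# * x + 1# * x   ≈⟨ +-cong (*-identityˡ x) (*-identityˡ x) ⟩
      x + x             ≈⟨ +-congˡ h ⟩
      x - x             ≈⟨ -‿inverseʳ x ⟩
      0#                ∎)

    -- Transpositions move column `suc b` to the left until it is next to `a`; swapping the two
    -- equal neighbours then gives `det M ≈ - det M`. The number `m` carries the recursion, because
    -- `inject₁ b` is not a structural subterm of `suc b`.
    det-equal-columns-< : ∀ {n} (M : Matrix Carrier (suc n)) a (b : Fin n) m → toℕ b ≡ m →
      toℕ a ℕ.≤ m → (∀ i → M i a ≈ M i (suc b)) → det M ≈ 0#
    det-equal-columns-< M a b m b≡m a≤m same with a Fin.≟ inject₁ b
    ... | yes ≡.refl = self-negative (trans (det-cong swapped) (det-swap M b))
      where
      swapped : ∀ i j → M i j ≈ M i (swapAdjacent b j)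
      swapped i j with j Fin.≟ inject₁ b | j Fin.≟ suc b
      ... | yes ≡.refl | _ =
        trans (same i) (reflexive (≡.cong (M i) (≡.sym (swapAdjacent-inject₁ b))))
      ... | no _ | yes ≡.refl =
        trans (sym (same i)) (reflexive (≡.cong (M i) (≡.sym (swapAdjacent-suc b))))
      ... | no p | no q = reflexive (≡.cong (M i) (≡.sym (swapAdjacent-other b j p q)))
    det-equal-columns-< M a zero m ≡.refl a≤m same | no a≢ =
      contradiction (Fin.toℕ-injective (ℕ.n≤0⇒n≡0 a≤m)) a≢
    det-equal-columns-< M a (suc b) (suc m) ≡.refl a≤m same | no a≢ = begin
      det M        ≈⟨ sym (-‿involutive _) ⟩
      - - det M    ≈⟨ -‿cong (sym (det-swap M (suc b))) ⟩
      - det M′     ≈⟨ -‿cong (det-equal-columns-< M′ a (inject₁ b) m (Fin.toℕ-inject₁ b)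
                        (ℕ.≤-pred (ℕ.≤∧≢⇒< a≤m λ e → a≢ (Fin.toℕ-injective
                          (≡.trans e (≡.sym (Fin.toℕ-inject₁ (suc b)))))))
                        same′) ⟩
      - 0#         ≈⟨ -0#≈0# ⟩
      0#           ∎
      where
      M′ : Matrix Carrier _
      M′ i j = M i (swapAdjacent (suc b) j)
      a≢′ : a ≢ suc (suc b)
      a≢′ ≡.refl = ℕ.1+n≰n a≤m
      same′ : ∀ i → M′ i a ≈ M′ i (suc (inject₁ b))
      same′ i = begin
        M i (swapAdjacent (suc b) a)  ≡⟨ ≡.cong (M i) (swapAdjacent-other (suc b) a a≢ a≢′) ⟩
        M i a                         ≈⟨ same i ⟩
        M i (suc (suc b))             ≡⟨ ≡.cong (M i) (swapAdjacent-inject₁ (suc b)) ⟨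
        M′ i (suc (inject₁ b))        ∎

    det-equal-columns : ∀ {n} (M : Matrix Carrier n) a b → a ≢ b →
      (∀ i → M i a ≈ M i b) → det M ≈ 0#
    det-equal-columns M a b a≢b same with Fin.<-cmp a b
    ... | tri≈ _ a≡b _ = contradiction a≡b a≢b
    det-equal-columns M a (suc b) a≢b same | tri< a<b _ _ =
      det-equal-columns-< M a b (toℕ b) ≡.refl (ℕ.≤-pred a<b) same
    det-equal-columns M (suc a) b a≢b same | tri> _ _ b<a =
      det-equal-columns-< M b a (toℕ a) ≡.refl (ℕ.≤-pred b<a) (sym ∘ same)

    -- By linearity in column `k`, the left side is the sum over `l` of `x l` times the determinant
    -- with column `k` overwritten by column `l`. For `l ≢ k` a column is repeated, so only `l = k`
    -- survives.
    cramer : ∀ {n} (M : Matrix Carrier n) (x : Vector Carrier n) k →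
      det (replaceColumn k (M *ᵥ x) M) ≈ x k * det M
    cramer {n} M x k = begin
      det (replaceColumn k (M *ᵥ x) M)   ≈⟨ det-linear-column _ P x k
        (λ l i j j≢k → reflexive
          (≡.trans (replaceColumn-off k _ M i j≢k) (≡.sym (replaceColumn-off k _ M i j≢k))))
        (λ i → trans (reflexive (replaceColumn-at k _ M i))
          (sum-cong-≋ {x = λ l → M i l * x l} {λ l → x l * P l i k} λ l → trans (*-comm _ _) (*-congˡ (reflexive (≡.sym (replaceColumn-at k (λ i → M i l) M i)))))) ⟩
      sum (λ l → x l * det (P l))
        ≈⟨ sum-single _ k (λ l l≢k → trans (*-congˡ (off l l≢k)) (zeroʳ _)) ⟩
      x k * det (P k)                    ≈⟨ *-congˡ (det-≡ at) ⟩
      x k * det M                        ∎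
      where
      P : Fin n → Matrix Carrier n
      P l = replaceColumn k (λ i → M i l) M
      off : ∀ l → l ≢ k → det (P l) ≈ 0#
      off l l≢k = det-equal-columns (P l) l k l≢k λ i → reflexive
        (≡.trans (replaceColumn-off k _ M i l≢k) (≡.sym (replaceColumn-at k _ M i)))
      at : ∀ i j → P k i j ≡ M i j
      at i j with j Fin.≟ k
      ... | yes ≡.refl = ≡.refl
      ... | no  _      = ≡.refl

    -- Kernels by elimination without division, for rectangular matrices

    infixl 7 _•_
    _•_ : ∀ {m n} → (Fin m → Vector Carrier n) → Vector Carrier n → Vector Carrier m
    (A • x) i = sum λ j → A i j * x j

    -- A nonzero coordinate is exhibited, which is stronger than refuting `x = 0`: this coordinate
    -- is what gets cancelled in Cramer's rule.
    Kernel : ∀ {m n} → (Fin m → Vector Carrier n) → Set (c ⊔ ℓ)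
    Kernel {n = n} A = ∃ λ (x : Vector Carrier n) → (∃ λ k → ¬ x k ≈ 0#) × (∀ i → (A • x) i ≈ 0#)

    *-≉0 : ∀ {x y} → ¬ x ≈ 0# → ¬ y ≈ 0# → ¬ x * y ≈ 0#
    *-≉0 p q e = q (cancel p e)

    -‿≉0 : ∀ {x} → ¬ x ≈ 0# → ¬ - x ≈ 0#
    -‿≉0 p e = p (trans (sym (-‿involutive _)) (trans (-‿cong e) -0#≈0#))

    -- Gaussian elimination of the first unknown, without division.
    underdetermined : ∀ {n} (A : Fin n → Vector Carrier (suc n)) → ¬ ¬ Kernel A
    underdetermined {zero}  A k = k ((λ _ → 1#) , (zero , 1≉0) , λ ())
    underdetermined {suc n} A k = ¬¬-all-or-counterexample (λ i → A i zero ≈ 0#) λ where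
        (inj₁ A₀≈0) → k (e₀ , (zero , 1≉0) , λ i →
          trans (sum-single (λ j → A i j * e₀ j) zero (vanish i)) (trans (*-congʳ (A₀≈0 i)) (zeroˡ _)))
        (inj₂ (p , A₀≉0)) → underdetermined (reduced p) λ where
          (x , (l , xₗ≉0) , Ax≈0) → k
            (lift p x , (suc l , *-≉0 A₀≉0 xₗ≉0) , λ i → solves p x Ax≈0 i (i Fin.≟ p))
      where
      e₀ : Vector Carrier (suc (suc n))
      e₀ zero    = 1#
      e₀ (suc _) = 0#
      vanish : ∀ i j → j ≢ zero → A i j * e₀ j ≈ 0#
      vanish i zero    j≢0 = contradiction ≡.refl j≢0
      vanish i (suc j) j≢0 = zeroʳ _

      rest : Fin (suc n) → Vector Carrier (suc n) → Carrier
      rest i x = sum λ j → A i (suc j) * x j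

      reduced : Fin (suc n) → Fin n → Vector Carrier (suc n)
      reduced p i j = A p zero * A (punchIn p i) (suc j) + - A (punchIn p i) zero * A p (suc j)

      -- Back substitution with the whole vector multiplied by the pivot `A p zero`: the first
      -- coordinate is then chosen to solve row `p` without a quotient.
      lift : Fin (suc n) → Vector Carrier (suc n) → Vector Carrier (suc (suc n))
      lift p x zero    = - rest p x
      lift p x (suc j) = A p zero * x j

      expand : ∀ p x i → (A • lift p x) i ≈ A i zero * - rest p x + A p zero * rest i x
      expand p x i = +-congˡ (begin
        sum (λ j → A i (suc j) * (A p zero * x j))  ≈⟨ sum-cong-≋ (λ j →
          solve 3 (λ a b x → a :* (b :* x) := b :* (a :* x)) refl (A i (suc j)) (A p zero) (x j)) ⟩
        sum (λ j → A p zero * (A i (suc j) * x j))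
          ≈⟨ sym (*-distribˡ-sum (A p zero) (λ j → A i (suc j) * x j)) ⟩
        A p zero * rest i x                         ∎)

      reduced-expand : ∀ p x i → (reduced p • x) i ≈
        A p zero * rest (punchIn p i) x + - A (punchIn p i) zero * rest p x
      reduced-expand p x i = begin
        sum (λ j → (a * u j + b * v j) * x j)
          ≈⟨ sum-cong-≋ (λ j → solve 5 (λ a u b v x → (a :* u :+ b :* v) :* x := a :* (u :* x) :+ b :* (v :* x))
               refl a (u j) b (v j) (x j)) ⟩
        sum (λ j → a * (u j * x j) + b * (v j * x j))
          ≈⟨ ∑-distrib-+ (λ j → a * (u j * x j)) (λ j → b * (v j * x j)) ⟩
        sum (λ j → a * (u j * x j)) + sum (λ j → b * (v j * x j))
          ≈⟨ sym (+-cong (*-distribˡ-sum a (λ j → u j * x j)) (*-distribˡ-sum b (λ j → v j * x j))) ⟩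
        a * rest (punchIn p i) x + b * rest p x ∎
        where
        a b : Carrier
        a = A p zero
        b = - A (punchIn p i) zero
        u v : Vector Carrier (suc n)
        u j = A (punchIn p i) (suc j)
        v j = A p (suc j)

      solves : ∀ p x → (∀ i → (reduced p • x) i ≈ 0#) → ∀ i → Dec (i ≡ p) → (A • lift p x) i ≈ 0#
      solves p x h i (yes ≡.refl) = begin
        (A • lift p x) p                              ≈⟨ expand p x p ⟩
        A p zero * - rest p x + A p zero * rest p x   ≈⟨ sym (distribˡ _ _ _) ⟩
        A p zero * (- rest p x + rest p x)            ≈⟨ *-congˡ (-‿inverseˡ _) ⟩
        A p zero * 0#                                 ≈⟨ zeroʳ _ ⟩
        0#                                            ∎
      solves p x h i (no i≢p) = begin
        (A • lift p x) i                                 ≈⟨ expand p x i ⟩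
        A i zero * - rest p x + A p zero * rest i x      ≈⟨ +-comm _ _ ⟩
        A p zero * rest i x + A i zero * - rest p x
          ≈⟨ +-congˡ (trans (sym (-‿distribʳ-* _ _)) (-‿distribˡ-* _ _)) ⟩
        A p zero * rest i x + - A i zero * rest p x
          ≡⟨ ≡.cong (λ t → A p zero * rest t x + - A t zero * rest p x) (Fin.punchIn-punchOut (i≢p ∘ ≡.sym)) ⟨
        _                                                ≈⟨ sym (reduced-expand p x _) ⟩
        (reduced p • x) (punchOut (i≢p ∘ ≡.sym))         ≈⟨ h _ ⟩
        0#                                               ∎

    sign≉0 : ∀ m → ¬ (- 1#) ^ m ≈ 0#
    sign≉0 zero    = 1≉0
    sign≉0 (suc m) = *-≉0 (-‿≉0 1≉0) (sign≉0 m)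

    •-extend : ∀ {m n} (A : Fin m → Vector Carrier (suc n)) k x i →
      (A • insertAt x k 0#) i ≈ ((λ i j → A i (punchIn k j)) • x) i
    •-extend A k x i = begin
      sum (λ j → A i j * insertAt x k 0# j)
        ≈⟨ sum-remove {i = k} (λ j → A i j * insertAt x k 0# j) ⟩
      A i k * insertAt x k 0# k + sum (λ j → A i (punchIn k j) * insertAt x k 0# (punchIn k j))
        ≈⟨ +-cong (trans (*-congˡ (reflexive (Vector.insertAt-lookup x k 0#))) (zeroʳ _))
                  (sum-cong-≋ λ j → *-congˡ (reflexive (Vector.insertAt-punchIn x k 0# j))) ⟩
      0# + sum (λ j → A i (punchIn k j) * x j)  ≈⟨ +-identityˡ _ ⟩
      sum (λ j → A i (punchIn k j) * x j)       ∎

    •-combine : ∀ {m n} (A : Fin m → Vector Carrier n) a b x y i →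
      (A • (λ j → a * x j + b * y j)) i ≈ a * (A • x) i + b * (A • y) i
    •-combine A a b x y i = begin
      sum (λ j → A i j * (a * x j + b * y j))
        ≈⟨ sum-cong-≋ (λ j → solve 5 (λ t a x b y → t :* (a :* x :+ b :* y) := a :* (t :* x) :+ b :* (t :* y))
             refl (A i j) a (x j) b (y j)) ⟩
      sum (λ j → a * (A i j * x j) + b * (A i j * y j))
        ≈⟨ ∑-distrib-+ (λ j → a * (A i j * x j)) (λ j → b * (A i j * y j)) ⟩
      sum (λ j → a * (A i j * x j)) + sum (λ j → b * (A i j * y j))
        ≈⟨ sym (+-cong (*-distribˡ-sum a (λ j → A i j * x j)) (*-distribˡ-sum b (λ j → A i j * y j))) ⟩
      a * (A • x) i + b * (A • y) i ∎

    -- Some x ≠ 0 is killed by all rows but the first.  If the first row does not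
    -- kill it and x k ≠ 0, Cramer's rule shows that the minor of the entry
    -- (0 , k) is singular, and its kernel supplies a second vector z with z k = 0;
    -- a combination of x and z is killed by the first row too.
    singular⇒kernel : ∀ {n} (M : Matrix Carrier n) → det M ≈ 0# → ¬ ¬ Kernel M
    singular⇒kernel {zero}  M det≈0 _ = 1≉0 det≈0
    singular⇒kernel {suc n} M det≈0 ret = underdetermined (M ∘ suc) λ where
        (x , (k , xₖ≉0) , Bx≈0) → ¬¬-excluded-middle λ where
          (yes c≈0) → ret (x , (k , xₖ≉0) , λ { zero → c≈0 ; (suc i) → Bx≈0 i })
          (no c≉0)  → singular⇒kernel (minor M k) (minor-singular x k Bx≈0 c≉0) λ where
            (z′ , (l , z′ₗ≉0) , Nz′≈0) → combine x k xₖ≉0 Bx≈0 (insertAt z′ k 0#) (punchIn k l)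
              (Vector.insertAt-lookup z′ k 0#)
              (λ e → z′ₗ≉0 (trans (reflexive (≡.sym (Vector.insertAt-punchIn z′ k 0# l))) e))
              (λ i → trans (•-extend M k z′ (suc i)) (Nz′≈0 i))
      where
      combine : ∀ x k → ¬ x k ≈ 0# → (∀ i → (M • x) (suc i) ≈ 0#) →
        ∀ z m → z k ≡ 0# → ¬ z m ≈ 0# → (∀ i → (M • z) (suc i) ≈ 0#) → ⊥
      combine x k xₖ≉0 Bx≈0 z m zₖ≡0 zₘ≉0 Bz≈0 = ¬¬-excluded-middle λ where
          (yes d≈0) → ret (z , (m , zₘ≉0) , λ { zero → d≈0 ; (suc i) → Bz≈0 i })
          (no d≉0)  → ret (w , (k , λ e → *-≉0 (-‿≉0 d≉0) xₖ≉0 (trans (sym wₖ) e)) , Mw≈0)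
        where
        a = (M • x) zero
        b = (M • z) zero
        w : Vector Carrier (suc n)
        -- The coefficients are the values of the first row at `x` and `z`, exchanged so that the
        -- first row cancels. As `z k` is zero, `w k` is `- b * x k`, which is nonzero.
        w j = a * z j + - b * x j
        wₖ : w k ≈ - b * x k
        wₖ = trans (+-congʳ (trans (*-congˡ (reflexive zₖ≡0)) (zeroʳ a))) (+-identityˡ _)
        Mw≈0 : ∀ i → (M • w) i ≈ 0#
        Mw≈0 zero = begin
          (M • w) zero     ≈⟨ •-combine M a (- b) z x zero ⟩
          a * b + - b * a  ≈⟨ +-cong (*-comm a b) (sym (-‿distribˡ-* b a)) ⟩
          b * a - b * a    ≈⟨ -‿inverseʳ _ ⟩
          0#               ∎
        Mw≈0 (suc i) = begin
          (M • w) (suc i)                              ≈⟨ •-combine M a (- b) z x (suc i) ⟩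
          a * (M • z) (suc i) + - b * (M • x) (suc i)
            ≈⟨ +-cong (*-congˡ (Bz≈0 i)) (*-congˡ (Bx≈0 i)) ⟩
          a * 0# + - b * 0#                            ≈⟨ +-cong (zeroʳ _) (zeroʳ _) ⟩
          0# + 0#                                      ≈⟨ +-identityˡ _ ⟩
          0#                                           ∎

      minor-singular : ∀ x k → (∀ i → (M • x) (suc i) ≈ 0#) → ¬ (M • x) zero ≈ 0# →
        det (minor M k) ≈ 0#
      -- Once column `k` is replaced by `M *ᵥ x`, only its top entry can be nonzero, so the
      -- determinant is that entry times the signed minor; Cramer's rule makes it zero.
      minor-singular x k Bx≈0 c≉0 = cancel (*-≉0 (sign≉0 (toℕ k)) c≉0) (begin
        (- 1#) ^ toℕ k * (M • x) zero * det (minor M k)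
          ≈⟨ *-cong (*-congˡ (reflexive (≡.sym (replaceColumn-at k (M *ᵥ x) M zero))))
                    (det-≡ λ i j → ≡.sym (replaceColumn-off k (M *ᵥ x) M (suc i) (Fin.punchInᵢ≢i k j))) ⟩
        laplaceTerm (replaceColumn k (M *ᵥ x) M) k
          ≈⟨ sym (det-unit-column (replaceColumn k (M *ᵥ x) M) k λ i → trans
                (reflexive (replaceColumn-at k (M *ᵥ x) M (suc i))) (Bx≈0 i)) ⟩
        det (replaceColumn k (M *ᵥ x) M)  ≈⟨ cramer M x k ⟩
        x k * det M                       ≈⟨ *-congˡ det≈0 ⟩
        x k * 0#                          ≈⟨ zeroʳ _ ⟩
        0#                                ∎)

    kernel⇒singular : ∀ {n} (M : Matrix Carrier n) → Kernel M → det M ≈ 0#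
    kernel⇒singular M (x , (k , xₖ≉0) , Mx≈0) = cancel xₖ≉0 (begin
      x k * det M                       ≈⟨ sym (cramer M x k) ⟩
      det (replaceColumn k (M *ᵥ x) M)  ≈⟨ det-zero-column _ k (λ i →
        trans (reflexive (replaceColumn-at k (M *ᵥ x) M i)) (Mx≈0 i)) ⟩
      0#                                ∎)

-- Characteristic polynomials

module CharacteristicPolynomials {c ℓ} (R : CommutativeRing c ℓ) where
  open CommutativeRing R hiding (zero)
  open RingProperties ring using (-‿distribʳ-*)
  open Determinants R using (det-cong)
  open Polynomial rawRing
  open SetoidReasoning setoid
  open import Algebra.Solver.Ring.NaturalCoefficients.Default commutativeSemiring
    using (solve; _:+_; _:*_; _:=_)
  open CharacteristicPolynomial rawRing using (charPoly)
  open RawMonoidDefinitions (RawRing.+-rawMonoid polyRawRing) using () renaming (sum to sumP)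
  open LinearAlgebra polyRawRing using () renaming (det to detP; diag to diagP)
  open LinearAlgebra rawRing using (det)
  open import Algebra.Definitions.RawSemiring (RawRing.rawSemiring rawRing) using (_^_)
  open import Algebra.Definitions.RawSemiring (RawRing.rawSemiring polyRawRing)
    using () renaming (_^_ to _^P_)
  open CommutativeMonoidSum +-commutativeMonoid using (sum; sum-cong-≋)
  open CommutativeMonoidSum *-commutativeMonoid using ()
    renaming (sum to product; sum-remove to product-remove; ∑-distrib-+ to product-*;
              sum-cong-≋ to product-cong; sum-replicate-zero to product-replicate-one)

  -1P : Poly
  -1P = RawRing.-_ polyRawRing (RawRing.1# polyRawRing)

  coeff-addP : ∀ p q k → coeff (addP p q) k ≈ coeff p k + coeff q k
  coeff-addP []      q       k       = sym (+-identityˡ _)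
  coeff-addP (a ∷ p) []      k       = sym (+-identityʳ _)
  coeff-addP (a ∷ p) (b ∷ q) zero    = refl
  coeff-addP (a ∷ p) (b ∷ q) (suc k) = coeff-addP p q k

  coeff-map-* : ∀ a p k → coeff (map (a *_) p) k ≈ a * coeff p k
  coeff-map-* a []      k       = sym (zeroʳ a)
  coeff-map-* a (b ∷ p) zero    = refl
  coeff-map-* a (b ∷ p) (suc k) = coeff-map-* a p k

  coeff-mulP-zero : ∀ p q → coeff (mulP p q) zero ≈ coeff p zero * coeff q zero
  coeff-mulP-zero []      q = sym (zeroˡ _)
  coeff-mulP-zero (a ∷ p) q = begin
    coeff (addP (map (a *_) q) (0# ∷ mulP p q)) zero  ≈⟨ coeff-addP (map (a *_) q) _ zero ⟩
    coeff (map (a *_) q) zero + 0#                    ≈⟨ +-identityʳ _ ⟩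
    coeff (map (a *_) q) zero                         ≈⟨ coeff-map-* a q zero ⟩
    a * coeff q zero                                  ∎

  -- Writing the tail of `p` as `drop 1 p` also covers the empty list, so that `scaled-*` can
  -- recurse on `k` alone.
  coeff-mulP-suc : ∀ p q k →
    coeff (mulP p q) (suc k) ≈ coeff p zero * coeff q (suc k) + coeff (mulP (drop 1 p) q) k
  coeff-mulP-suc []      q k = sym (trans (+-identityʳ _) (zeroˡ _))
  coeff-mulP-suc (a ∷ p) q k = trans (coeff-addP (map (a *_) q) _ (suc k)) (+-congʳ (coeff-map-* a q (suc k)))

  coeff-drop : ∀ p k → coeff (drop 1 p) k ≡ coeff p (suc k)
  coeff-drop []      k = ≡.refl
  coeff-drop (a ∷ p) k = ≡.refl

  coeff-sumP : ∀ {n} (f : Vector Poly n) k → coeff (sumP f) k ≈ sum (λ i → coeff (f i) k)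
  coeff-sumP {zero}  f k = refl
  coeff-sumP {suc n} f k = trans (coeff-addP (f zero) _ k) (+-congˡ (coeff-sumP (f ∘ suc) k))

  -- Equality up to a scalar factor; it carries the effect of scaling rows and columns through the
  -- Laplace expansion.
  Scaled : Carrier → Poly → Poly → Set ℓ
  Scaled a p q = ∀ k → coeff p k ≈ a * coeff q k

  scaled-refl : ∀ p → Scaled 1# p p
  scaled-refl p k = sym (*-identityˡ _)

  scaled-resp : ∀ {a b p q} → a ≈ b → Scaled a p q → Scaled b p q
  scaled-resp e h k = trans (h k) (*-congʳ e)

  scaled-drop : ∀ {a p q} → Scaled a p q → Scaled a (drop 1 p) (drop 1 q)
  scaled-drop {a} {p} {q} h k = begin
    coeff (drop 1 p) k      ≡⟨ coeff-drop p k ⟩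
    coeff p (suc k)         ≈⟨ h (suc k) ⟩
    a * coeff q (suc k)     ≡⟨ ≡.cong (a *_) (coeff-drop q k) ⟨
    a * coeff (drop 1 q) k  ∎

  scaled-* : ∀ {a b p p′ q q′} → Scaled a p p′ → Scaled b q q′ → Scaled (a * b) (mulP p q) (mulP p′ q′)
  scaled-* {a} {b} {p} {p′} {q} {q′} h h′ zero = begin
    coeff (mulP p q) zero                               ≈⟨ coeff-mulP-zero p q ⟩
    coeff p zero * coeff q zero                         ≈⟨ *-cong (h zero) (h′ zero) ⟩
    (a * coeff p′ zero) * (b * coeff q′ zero)
      ≈⟨ solve 4 (λ a p b q → (a :* p) :* (b :* q) := (a :* b) :* (p :* q)) refl a _ b _ ⟩
    a * b * (coeff p′ zero * coeff q′ zero)             ≈⟨ *-congˡ (sym (coeff-mulP-zero p′ q′)) ⟩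
    a * b * coeff (mulP p′ q′) zero                     ∎
  scaled-* {a} {b} {p} {p′} {q} {q′} h h′ (suc k) = begin
    coeff (mulP p q) (suc k)
      ≈⟨ coeff-mulP-suc p q k ⟩
    coeff p zero * coeff q (suc k) + coeff (mulP (drop 1 p) q) k
      ≈⟨ +-cong (*-cong (h zero) (h′ (suc k))) (scaled-* {p = drop 1 p} {drop 1 p′} (scaled-drop {p = p} {p′} h) h′ k) ⟩
    (a * coeff p′ zero) * (b * coeff q′ (suc k)) + a * b * coeff (mulP (drop 1 p′) q′) k
      ≈⟨ solve 5 (λ a p b q r → (a :* p) :* (b :* q) :+ a :* b :* r := (a :* b) :* (p :* q :+ r)) refl a _ b _ _ ⟩
    a * b * (coeff p′ zero * coeff q′ (suc k) + coeff (mulP (drop 1 p′) q′) k)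
      ≈⟨ *-congˡ (sym (coeff-mulP-suc p′ q′ k)) ⟩
    a * b * coeff (mulP p′ q′) (suc k) ∎

  scaled-+ : ∀ {a p p′ q q′} → Scaled a p p′ → Scaled a q q′ → Scaled a (addP p q) (addP p′ q′)
  scaled-+ {a} {p} {p′} {q} {q′} h h′ k = begin
    coeff (addP p q) k               ≈⟨ coeff-addP p q k ⟩
    coeff p k + coeff q k            ≈⟨ +-cong (h k) (h′ k) ⟩
    a * coeff p′ k + a * coeff q′ k  ≈⟨ sym (distribˡ a _ _) ⟩
    a * (coeff p′ k + coeff q′ k)    ≈⟨ *-congˡ (sym (coeff-addP p′ q′ k)) ⟩
    a * coeff (addP p′ q′) k         ∎

  scaled-sum : ∀ {n a} {f g : Vector Poly n} → (∀ i → Scaled a (f i) (g i)) → Scaled a (sumP f) (sumP g)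
  scaled-sum {zero}  {a} h k = sym (zeroʳ a)
  scaled-sum {suc n} {f = f} {g} h = scaled-+ {p = f zero} {g zero} (h zero) (scaled-sum (h ∘ suc))

  -- In the term of column `j`, the entry contributes `s zero * t j` and the minor contributes all
  -- the other factors, so every term is scaled by the same product.
  scaled-det : ∀ {n} (s t : Vector Carrier n) {M N : Matrix Poly n} →
    (∀ i j → Scaled (s i * t j) (M i j) (N i j)) → Scaled (product s * product t) (detP M) (detP N)
  scaled-det {zero}  s t h = scaled-resp {p = constant 1#} {constant 1#} (sym (*-identityˡ 1#)) (scaled-refl (constant 1#))
  scaled-det {suc n} s t {M} {N} h = scaled-sum {f = term M} {term N} λ j →
    scaled-resp {p = term M j} {term N j}
      (begin
        1# * (s zero * t j) * (product (s ∘ suc) * product (t ∘ punchIn j))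
          ≈⟨ *-congʳ (*-identityˡ _) ⟩
        s zero * t j * (product (s ∘ suc) * product (t ∘ punchIn j))
          ≈⟨ solve 4 (λ a b c d → a :* b :* (c :* d) := a :* c :* (b :* d)) refl (s zero) (t j) _ _ ⟩
        product s * (t j * product (t ∘ punchIn j))
          ≈⟨ *-congˡ (sym (product-remove {i = j} t)) ⟩
        product s * product t ∎)
      (scaled-* {p = mulP (sign j) (M zero j)} {mulP (sign j) (N zero j)} {detP (minor M j)} {detP (minor N j)}
        (scaled-* {p = sign j} {sign j} {M zero j} {N zero j} (scaled-refl (sign j)) (h zero j))
        (scaled-det (s ∘ suc) (t ∘ punchIn j) {minor M j} {minor N j} λ i k → h (suc i) (punchIn j k)))
    where
    sign : Fin (suc n) → Poly
    sign j = -1P ^P toℕ j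
    minor : Matrix Poly (suc n) → Fin (suc n) → Matrix Poly n
    minor M j i k = M (suc i) (punchIn j k)
    term : Matrix Poly (suc n) → Fin (suc n) → Poly
    term M j = mulP (mulP (sign j) (M zero j)) (detP (minor M j))

  -- Conjugation by `diag s`, whose inverse is `diag t`. The entries of `X I - M` scale by
  -- `s i * t j` too, since `X` occurs only on the diagonal, where the factor is 1; the total factor
  -- of the determinant is 1 as well.
  similar⇒cospectral : ∀ {n} (s t : Vector Carrier n) {M N : Matrix Carrier n} →
    (∀ i → s i * t i ≈ 1#) → (∀ i j → M i j ≈ s i * t j * N i j) →
    ∀ k → coeff (charPoly M) k ≈ coeff (charPoly N) k
  similar⇒cospectral {n} s t {M} {N} st≈1 h k = begin
    coeff (charPoly M) k                         ≈⟨ scaled-det s t entry k ⟩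
    product s * product t * coeff (charPoly N) k ≈⟨ *-congʳ product≈1 ⟩
    1# * coeff (charPoly N) k                    ≈⟨ *-identityˡ _ ⟩
    coeff (charPoly N) k                         ∎
    where
    product≈1 : product s * product t ≈ 1#
    product≈1 = trans (sym (product-* s t)) (trans (product-cong st≈1) (product-replicate-one n))

    negated : ∀ i j → - M i j ≈ s i * t j * - N i j
    negated i j = trans (-‿cong (h i j)) (-‿distribʳ-* _ _)

    entry : ∀ i j → Scaled (s i * t j) (addP (diagP (λ _ → X) i j) (map -_ (constant (M i j))))
                                       (addP (diagP (λ _ → X) i j) (map -_ (constant (N i j))))
    entry i j k with i Fin.≟ j
    entry i j zero | no _ = negated i j
    entry i j (suc k) | no _ = sym (zeroʳ _)
    entry i j zero | yes _ = trans (+-identityˡ _) (trans (negated i j) (*-congˡ (sym (+-identityˡ _))))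
    entry i .i (suc zero) | yes ≡.refl = sym (trans (*-identityʳ _) (st≈1 i))
    entry i j (suc (suc k)) | yes _ = sym (zeroʳ _)

  coeff₀-^ : ∀ m → coeff (-1P ^P m) zero ≈ (- 1#) ^ m
  coeff₀-^ zero    = refl
  coeff₀-^ (suc m) = trans (coeff-mulP-zero -1P (-1P ^P m)) (*-congˡ (coeff₀-^ m))

  -- Taking the constant coefficient respects sums and products, hence commutes with the Laplace
  -- expansion.
  coeff₀-det : ∀ {n} (M : Matrix Poly n) → coeff (detP M) zero ≈ det (λ i j → coeff (M i j) zero)
  coeff₀-det {zero}  M = refl
  coeff₀-det {suc n} M = trans (coeff-sumP term zero) (sum-cong-≋ λ j → begin
      coeff (term j) zero
        ≈⟨ coeff-mulP-zero (mulP (-1P ^P toℕ j) (M zero j)) _ ⟩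
      coeff (mulP (-1P ^P toℕ j) (M zero j)) zero * coeff (detP (minor j)) zero
        ≈⟨ *-cong (trans (coeff-mulP-zero (-1P ^P toℕ j) (M zero j)) (*-congʳ (coeff₀-^ (toℕ j))))
                  (coeff₀-det (minor j)) ⟩
      (- 1#) ^ toℕ j * coeff (M zero j) zero * det (λ i k → coeff (minor j i k) zero) ∎)
    where
    minor : Fin (suc n) → Matrix Poly n
    minor j i k = M (suc i) (punchIn j k)
    term : Fin (suc n) → Poly
    term j = mulP (mulP (-1P ^P toℕ j) (M zero j)) (detP (minor j))

  coeff₀-entry : ∀ {n} (M : Matrix Carrier n) i j →
    coeff (addP (diagP (λ _ → X) i j) (map -_ (constant (M i j)))) zero ≈ - M i j
  coeff₀-entry M i j with i Fin.≟ j
  ... | yes _ = +-identityˡ _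
  ... | no _  = refl

  coeff₀-charPoly : ∀ {n} (M : Matrix Carrier n) →
    coeff (charPoly M) zero ≈ det (λ i j → - M i j)
  coeff₀-charPoly M = trans
    (coeff₀-det λ i j → addP (diagP (λ _ → X) i j) (map -_ (constant (M i j))))
    (det-cong (coeff₀-entry M))

-- Real and complex numbers

module _ where
  open ℝ
  open _≈ʳ_
  open ℚ-Solver.+-*-Solver using (solve; _:+_; _:*_; :-_; _:-_; _:=_; con)

  Eventually : (ℕ → Set) → Set
  Eventually P = ∃ λ N → ∀ n → N ℕ.≤ n → P n

  eventually-map : ∀ {P Q} → (∀ n → P n → Q n) → Eventually P → Eventually Q
  eventually-map f (N , p) = N , λ n h → f n (p n h)

  eventually-× : ∀ {P Q} → Eventually P → Eventually Q → Eventually λ n → P n × Q n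
  eventually-× (N , p) (M , q) =
    N ℕ.⊔ M , λ n h → p n (ℕ.m⊔n≤o⇒m≤o N M h) , q n (ℕ.m⊔n≤o⇒n≤o N M h)

  eventually-const : ∀ {A : Set} → Eventually (λ _ → A) → A
  eventually-const (N , p) = p N ℕ.≤-refl

  <⇒≱ : ∀ {p q} → p ℚ.< q → ¬ q ℚ.≤ p
  <⇒≱ p<q q≤p = ℚ.<-irrefl ≡.refl (ℚ.<-≤-trans p<q q≤p)

  ½-pos : ∀ {δ} → 0ℚ ℚ.< δ → 0ℚ ℚ.< ½ ℚ.* δ
  ½-pos {δ} p = ≡.subst (ℚ._< ½ ℚ.* δ) (ℚ.*-zeroʳ ½) (ℚ.*-monoʳ-<-pos ½ p)

  ½+½ : ∀ δ → ½ ℚ.* δ ℚ.+ ½ ℚ.* δ ≡ δ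
  ½+½ δ = ≡.trans (≡.sym (ℚ.*-distribʳ-+ δ ½ ½)) (ℚ.*-identityˡ δ)

  ½δ<δ : ∀ {δ} → 0ℚ ℚ.< δ → ½ ℚ.* δ ℚ.< δ
  ½δ<δ {δ} p = ≡.subst₂ ℚ._<_ (ℚ.+-identityʳ (½ ℚ.* δ)) (½+½ δ) (ℚ.+-monoʳ-< (½ ℚ.* δ) (½-pos p))

  ∣∣-perturb : ∀ p q {δ} → ℚ.∣ p ∣ ℚ.< ½ ℚ.* δ → ℚ.∣ q ℚ.- p ∣ ℚ.< ½ ℚ.* δ → ℚ.∣ q ∣ ℚ.< δ
  ∣∣-perturb p q {δ} a b = ≡.subst₂ ℚ._<_
    (≡.cong ℚ.∣_∣ (solve 2 (λ p q → p :+ (q :- p) := q) ≡.refl p q)) (½+½ δ)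
    (ℚ.≤-<-trans (ℚ.∣p+q∣≤∣p∣+∣q∣ p (q ℚ.- p)) (ℚ.+-mono-< a b))

  close-0 : ∀ {x} → (∀ δ → 0ℚ ℚ.< δ → Eventually λ n → ℚ.∣ seq x n ∣ ℚ.< δ) → x ≈ʳ fromℚ 0ℚ
  close-0 {x} h = mk≈ʳ λ δ δ>0 → eventually-map
    (λ n → ≡.subst (λ t → ℚ.∣ t ∣ ℚ.< δ) (≡.sym (ℚ.+-identityʳ (seq x n)))) (h δ δ>0)

  0-close : ∀ {x} → x ≈ʳ fromℚ 0ℚ → ∀ δ → 0ℚ ℚ.< δ → Eventually λ n → ℚ.∣ seq x n ∣ ℚ.< δ
  0-close {x} e δ δ>0 = eventually-map
    (λ n → ≡.subst (λ t → ℚ.∣ t ∣ ℚ.< δ) (ℚ.+-identityʳ (seq x n))) (close e δ δ>0)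

  -- A single term, past which the sequence varies by less than δ/4, is compared with δ/2; this
  -- comparison of rationals is decidable. The lower bound in the second case is δ/4.
  small-or-large : ∀ x δ → 0ℚ ℚ.< δ →
    Eventually (λ n → ℚ.∣ seq x n ∣ ℚ.< δ) ⊎
    ∃ λ η → 0ℚ ℚ.< η × Eventually (λ n → η ℚ.≤ ℚ.∣ seq x n ∣)
  small-or-large x δ δ>0 with cauchy x (½ ℚ.* (½ ℚ.* δ)) (½-pos (½-pos δ>0))
  ... | N , f with ℚ.∣ seq x N ∣ ℚ.<? ½ ℚ.* δ
  ... | yes small = inj₁ (N , λ n h → ∣∣-perturb (seq x N) (seq x n) small
    (ℚ.<-trans (f n N h ℕ.≤-refl) (½δ<δ (½-pos δ>0))))
  ... | no large = inj₂ (½ ℚ.* (½ ℚ.* δ) , ½-pos (½-pos δ>0) , N , λ n h →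
    ℚ.≮⇒≥ λ c → large (∣∣-perturb (seq x n) (seq x N) c (f N n ℕ.≤-refl h)))

  -- A positive lower bound on the tail refutes `x ≈ 0`, so at every scale only the small
  -- alternative remains.
  ≈0-stable : ∀ {x} → ¬ ¬ x ≈ʳ fromℚ 0ℚ → x ≈ʳ fromℚ 0ℚ
  ≈0-stable {x} ¬¬x≈0 = close-0 λ δ δ>0 → case δ δ>0
    where
    case : ∀ δ → 0ℚ ℚ.< δ → Eventually λ n → ℚ.∣ seq x n ∣ ℚ.< δ
    case δ δ>0 with small-or-large x δ δ>0
    ... | inj₁ small = small
    ... | inj₂ (η , η>0 , large) = contradiction
      (λ x≈0 → eventually-const (eventually-map (λ n (a , b) → <⇒≱ b a)
        (eventually-× large (0-close x≈0 η η>0))))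
      ¬¬x≈0

  -- If `y` stayed above some η, then `x` would be small at every scale, because lower bounds on
  -- both factors bound the product away from zero.
  ℝ-cancel : ∀ {x y} → ¬ x ≈ʳ fromℚ 0ℚ → x *ʳ y ≈ʳ fromℚ 0ℚ → y ≈ʳ fromℚ 0ℚ
  ℝ-cancel {x} {y} x≉0 xy≈0 = close-0 case
    where
    case : ∀ δ → 0ℚ ℚ.< δ → Eventually λ n → ℚ.∣ seq y n ∣ ℚ.< δ
    case δ δ>0 with small-or-large y δ δ>0
    ... | inj₁ small = small
    ... | inj₂ (η , η>0 , large-y) = contradiction (close-0 case′) x≉0
      where
      case′ : ∀ γ → 0ℚ ℚ.< γ → Eventually λ n → ℚ.∣ seq x n ∣ ℚ.< γ
      case′ γ γ>0 with small-or-large x γ γ>0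
      ... | inj₁ small = small
      ... | inj₂ (ζ , ζ>0 , large-x) = ⊥-elim (eventually-const (eventually-map
        (λ n (a , b , c) → <⇒≱ c (product n a b))
        (eventually-× large-x (eventually-× large-y (0-close xy≈0 (ζ ℚ.* η) ζη>0)))))
        where
        instance
          posζ : ℚ.Positive ζ
          posζ = ℚ.positive ζ>0
          nnζ : ℚ.NonNegative ζ
          nnζ = ℚ.pos⇒nonNeg ζ
        ζη>0 : 0ℚ ℚ.< ζ ℚ.* η
        ζη>0 = ≡.subst (ℚ._< ζ ℚ.* η) (ℚ.*-zeroʳ ζ) (ℚ.*-monoʳ-<-pos ζ η>0)
        product : ∀ n → ζ ℚ.≤ ℚ.∣ seq x n ∣ → η ℚ.≤ ℚ.∣ seq y n ∣ →
          ζ ℚ.* η ℚ.≤ ℚ.∣ seq x n ℚ.* seq y n ∣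
        product n a b = ≡.subst (ζ ℚ.* η ℚ.≤_) (≡.sym (ℚ.∣p*q∣≡∣p∣*∣q∣ (seq x n) (seq y n)))
          (ℚ.≤-trans (ℚ.*-monoˡ-≤-nonNeg ζ b)
                     (ℚ.*-monoʳ-≤-nonNeg ℚ.∣ seq y n ∣ {{ℚ.∣-∣-nonNeg (seq y n)}} a))

  ℝ-1≉0 : ¬ fromℚ 1ℚ ≈ʳ fromℚ 0ℚ
  ℝ-1≉0 e = eventually-const (eventually-map (λ _ → ℚ.<-irrefl ≡.refl)
    (0-close e 1ℚ (ℚ.positive⁻¹ 1ℚ)))


  ℝ-2≉0 : ¬ fromℚ 1ℚ +ʳ fromℚ 1ℚ ≈ʳ fromℚ 0ℚ
  ℝ-2≉0 e = eventually-const (eventually-map (λ _ → from-no (1ℚ ℚ.+ 1ℚ ℚ.<? 1ℚ))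
    (0-close e 1ℚ (ℚ.positive⁻¹ 1ℚ)))

  -- The order on the real numbers

  record NonNegative (x : ℝ) : Set where
    no-eta-equality
    constructor mkNonNegative
    field
      above : ∀ δ → 0ℚ ℚ.< δ → Eventually λ n → 0ℚ ℚ.< seq x n ℚ.+ δ

  open NonNegative

  p≤∣p∣ : ∀ p → p ℚ.≤ ℚ.∣ p ∣
  p≤∣p∣ p with ℚ.≤-total 0ℚ p
  ... | inj₁ 0≤p = ℚ.≤-reflexive (≡.sym (ℚ.0≤p⇒∣p∣≡p 0≤p))
  ... | inj₂ p≤0 = ℚ.≤-trans p≤0 (ℚ.0≤∣p∣ p)

  0≤p*p : ∀ p → 0ℚ ℚ.≤ p ℚ.* p
  0≤p*p p with ℚ.≤-total 0ℚ p
  ... | inj₁ 0≤p =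
    ℚ.nonNegative⁻¹ _ {{ℚ.nonNeg*nonNeg⇒nonNeg p {{ℚ.nonNegative 0≤p}} p {{ℚ.nonNegative 0≤p}}}}
  ... | inj₂ p≤0 =
    ℚ.nonNegative⁻¹ _ {{ℚ.nonPos*nonPos⇒nonPos p {{ℚ.nonPositive p≤0}} p {{ℚ.nonPositive p≤0}}}}

  <-of-close : ∀ p q {δ} → ℚ.∣ p ℚ.- q ∣ ℚ.< δ → p ℚ.< q ℚ.+ δ
  <-of-close p q {δ} h = ≡.subst (ℚ._< q ℚ.+ δ) (solve 2 (λ p q → q :+ (p :- q) := p) ≡.refl p q)
    (ℚ.+-monoʳ-< q (ℚ.≤-<-trans (p≤∣p∣ (p ℚ.- q)) h))

  weaken-½ : ∀ p q δ → 0ℚ ℚ.< p ℚ.+ ½ ℚ.* δ → p ℚ.< q ℚ.+ ½ ℚ.* δ → 0ℚ ℚ.< q ℚ.+ δ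
  weaken-½ p q δ a b = ≡.subst (0ℚ ℚ.<_)
    (≡.trans (ℚ.+-assoc q (½ ℚ.* δ) (½ ℚ.* δ)) (≡.cong (q ℚ.+_) (½+½ δ)))
    (ℚ.<-trans a (ℚ.+-monoˡ-< (½ ℚ.* δ) b))

  <-+-pos : ∀ {p δ} → 0ℚ ℚ.≤ p → 0ℚ ℚ.< δ → 0ℚ ℚ.< p ℚ.+ δ
  <-+-pos {p} {δ} = ℚ.+-mono-≤-< {0ℚ} {p} {0ℚ} {δ}

  nonNegative-resp-≈ : ∀ {x y} → x ≈ʳ y → NonNegative x → NonNegative y
  nonNegative-resp-≈ {x} {y} e x≥0 = mkNonNegative λ δ δ>0 → eventually-map
    (λ n (a , b) → weaken-½ (seq x n) (seq y n) δ a (<-of-close (seq x n) (seq y n) b))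
    (eventually-× (above x≥0 (½ ℚ.* δ) (½-pos δ>0)) (close e (½ ℚ.* δ) (½-pos δ>0)))

  nonNegative-+ : ∀ {x y} → NonNegative x → NonNegative y → NonNegative (x +ʳ y)
  nonNegative-+ {x} {y} x≥0 y≥0 = mkNonNegative λ δ δ>0 → eventually-map
    (λ n (a , b) → ≡.subst (0ℚ ℚ.<_)
      (≡.trans (solve 3 (λ p q h → (p :+ h) :+ (q :+ h) := (p :+ q) :+ (h :+ h)) ≡.refl
                (seq x n) (seq y n) (½ ℚ.* δ))
               (≡.cong (seq x n ℚ.+ seq y n ℚ.+_) (½+½ δ)))
      (ℚ.+-mono-< a b))
    (eventually-× (above x≥0 (½ ℚ.* δ) (½-pos δ>0)) (above y≥0 (½ ℚ.* δ) (½-pos δ>0)))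

  nonNegative-square : ∀ x → NonNegative (x *ʳ x)
  nonNegative-square x = mkNonNegative λ δ δ>0 → 0 , λ n _ → <-+-pos (0≤p*p (seq x n)) δ>0

  nonNegative-0 : NonNegative (fromℚ 0ℚ)
  nonNegative-0 = mkNonNegative λ δ δ>0 → 0 , λ n _ → <-+-pos {0ℚ} ℚ.≤-refl δ>0

  nonNegative-antisym : ∀ {x} → NonNegative x → NonNegative (-ʳ x) → x ≈ʳ fromℚ 0ℚ
  nonNegative-antisym {x} x≥0 -x≥0 = close-0 λ δ δ>0 → eventually-map
    (λ n (a , b) → bound (seq x n) a b)
    (eventually-× (above x≥0 δ δ>0) (above -x≥0 δ δ>0))
    where
    bound : ∀ p {δ} → 0ℚ ℚ.< p ℚ.+ δ → 0ℚ ℚ.< ℚ.- p ℚ.+ δ → ℚ.∣ p ∣ ℚ.< δ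
    bound p {δ} a b with ℚ.∣p∣≡p∨∣p∣≡-p p
    ... | inj₁ e = ≡.subst (ℚ._< δ) (≡.sym e) (≡.subst₂ ℚ._<_ (ℚ.+-identityʳ p)
      (solve 2 (λ p d → p :+ (:- p :+ d) := d) ≡.refl p δ) (ℚ.+-monoʳ-< p b))
    ... | inj₂ e = ≡.subst (ℚ._< δ) (≡.sym e) (≡.subst₂ ℚ._<_ (ℚ.+-identityʳ (ℚ.- p))
      (solve 2 (λ p d → :- p :+ (p :+ d) := d) ≡.refl p δ) (ℚ.+-monoʳ-< (ℚ.- p) a))

  -- A term `seq x N` known up to δ/2 decides: if it is below δ/2, then `-ʳ x` stays above -δ;
  -- otherwise all later terms are positive, contrary to the hypothesis.
  nonNegative-total : ∀ {x} → ¬ NonNegative x → NonNegative (-ʳ x)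
  nonNegative-total {x} x≱0 = mkNonNegative case
    where
    case : ∀ δ → 0ℚ ℚ.< δ → Eventually λ n → 0ℚ ℚ.< ℚ.- seq x n ℚ.+ δ
    case δ δ>0 with cauchy x (½ ℚ.* δ) (½-pos δ>0)
    ... | N , f with 0ℚ ℚ.<? ℚ.- seq x N ℚ.+ ½ ℚ.* δ
    ... | yes p = N , λ n h → weaken-½ (ℚ.- seq x N) (ℚ.- seq x n) δ p (≡.subst₂ ℚ._<_
      (solve 2 (λ p q → p :+ (:- p :+ :- q) := :- q) ≡.refl (seq x n) (seq x N))
      (solve 3 (λ p q h → (q :+ h) :+ (:- p :+ :- q) := :- p :+ h) ≡.refl (seq x n) (seq x N) (½ ℚ.* δ))
      (ℚ.+-monoˡ-< (ℚ.- seq x n ℚ.+ ℚ.- seq x N) (<-of-close (seq x n) (seq x N) (f n N h ℕ.≤-refl))))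
    ... | no ¬p = contradiction (mkNonNegative λ γ γ>0 → N , λ n h →
      <-+-pos (ℚ.<⇒≤ (≡.subst₂ ℚ._<_
        (solve 2 (λ a h → (:- a :+ h) :+ (a :+ :- h) := con 0ℚ) ≡.refl (seq x N) (½ ℚ.* δ))
        (solve 2 (λ b h → (b :+ h) :+ :- h := b) ≡.refl (seq x n) (½ ℚ.* δ))
        (ℚ.≤-<-trans (ℚ.+-monoˡ-≤ (seq x N ℚ.+ ℚ.- (½ ℚ.* δ)) (ℚ.≮⇒≥ ¬p))
          (≡.subst (ℚ._< seq x n ℚ.+ ½ ℚ.* δ ℚ.+ ℚ.- (½ ℚ.* δ))
            (≡.sym (ℚ.+-identityˡ _))
            (ℚ.+-monoˡ-< (ℚ.- (½ ℚ.* δ)) (<-of-close (seq x N) (seq x n) (f N n ℕ.≤-refl h))))))) γ>0) x≱0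

  module _ where
    open ℝ-Ring hiding (zero)
    open RingProperties ring using (+-inverseʳ-unique)
    open SemiringSum semiring using (sum; sum-remove)
    open SetoidReasoning setoid

    nonNegative-sum : ∀ {n} {f : Vector ℝ n} → (∀ i → NonNegative (f i)) → NonNegative (sum f)
    nonNegative-sum {zero}  h = nonNegative-0
    nonNegative-sum {suc n} h = nonNegative-+ (h zero) (nonNegative-sum (h ∘ suc))

    nonNegative-+-zeroˡ : ∀ {x y} → NonNegative x → NonNegative y → x + y ≈ 0# → x ≈ 0#
    nonNegative-+-zeroˡ {x} {y} x≥0 y≥0 e = nonNegative-antisym x≥0
      (nonNegative-resp-≈ (+-inverseʳ-unique x y e) y≥0)

    nonNegative-sum-zero : ∀ {n} {f : Vector ℝ n} → (∀ i → NonNegative (f i)) →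
      sum f ≈ 0# → ∀ i → f i ≈ 0#
    nonNegative-sum-zero {suc n} {f} h e i = nonNegative-+-zeroˡ (h i)
      (nonNegative-sum (h ∘ punchIn i)) (trans (sym (sum-remove {i = i} f)) e)

    square≈0 : ∀ {x} → x * x ≈ 0# → x ≈ 0#
    square≈0 e = ≈0-stable λ x≉0 → x≉0 (ℝ-cancel x≉0 e)

  -- The running maximum is compared with each new value by excluded middle, and `nonNegative-total`
  -- supplies the reverse inequality. The index given guarantees a nonempty family.
  ¬¬-maximum : ∀ {n} → Fin n → (f : Vector ℝ n) →
    ¬ ¬ ∃ λ i → ∀ j → NonNegative (f i +ʳ -ʳ f j)
  ¬¬-maximum {suc n} _ = search
    where
    self : ∀ x → NonNegative (x +ʳ -ʳ x)
    self x = nonNegative-resp-≈ (ℝ-Ring.sym (ℝ-Ring.-‿inverseʳ x)) nonNegative-0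
    telescope : ∀ x y z → (x +ʳ -ʳ y) +ʳ (y +ʳ -ʳ z) ≈ʳ x +ʳ -ʳ z
    telescope x y z = ≈ʳ-pointwise λ n → solve 3 (λ a b c → (a :+ :- b) :+ (b :+ :- c) := a :+ :- c)
      ≡.refl (seq x n) (seq y n) (seq z n)
    flipped : ∀ x y → -ʳ (x +ʳ -ʳ y) ≈ʳ y +ʳ -ʳ x
    flipped x y = ≈ʳ-pointwise λ n → solve 2 (λ a b → :- (a :+ :- b) := b :+ :- a)
      ≡.refl (seq x n) (seq y n)

    search : ∀ {m} (f : Vector ℝ (suc m)) → ¬ ¬ ∃ λ i → ∀ j → NonNegative (f i +ʳ -ʳ f j)
    search {zero}  f k = k (zero , λ { zero → self (f zero) })
    search {suc m} f k = search (f ∘ suc) λ (i , max) →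
      ¬¬-excluded-middle {A = NonNegative (f zero +ʳ -ʳ f (suc i))} λ where
        (yes above) → k (zero , λ where
          zero    → self (f zero)
          (suc j) → nonNegative-resp-≈ (telescope (f zero) (f (suc i)) (f (suc j))) (nonNegative-+ above (max j)))
        (no ¬above) → k (suc i , λ where
          zero    → nonNegative-resp-≈ (flipped (f zero) (f (suc i))) (nonNegative-total ¬above)
          (suc j) → max j)

  -- Complex numbers: squared modulus, cancellation and the real inner product

  open ℂ
  open _≈ᶜ_

  ∣∣²-cong : ∀ {z w} → z ≈ᶜ w → ∣ z ∣² ≈ʳ ∣ w ∣²
  ∣∣²-cong e = ℝ-Ring.+-cong (ℝ-Ring.*-cong (re-≈ e) (re-≈ e)) (ℝ-Ring.*-cong (im-≈ e) (im-≈ e))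

  ∣∣²-* : ∀ z w → ∣ z *ᶜ w ∣² ≈ʳ ∣ z ∣² *ʳ ∣ w ∣²
  ∣∣²-* z w = ≈ʳ-pointwise λ n → solve 4 (λ a b c d →
    (a :* c :+ :- (b :* d)) :* (a :* c :+ :- (b :* d)) :+ (a :* d :+ b :* c) :* (a :* d :+ b :* c) :=
    (a :* a :+ b :* b) :* (c :* c :+ d :* d))
    ≡.refl (seq (re z) n) (seq (im z) n) (seq (re w) n) (seq (im w) n)

  ∣∣²-nonNegative : ∀ z → NonNegative ∣ z ∣²
  ∣∣²-nonNegative z = nonNegative-+ (nonNegative-square (re z)) (nonNegative-square (im z))

  ∣∣²≈0⇒≈0 : ∀ {z} → ∣ z ∣² ≈ʳ fromℚ 0ℚ → z ≈ᶜ 0ᶜ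
  ∣∣²≈0⇒≈0 {z} e = mk≈ᶜ
    (square≈0 (nonNegative-+-zeroˡ (nonNegative-square (re z)) (nonNegative-square (im z)) e))
    (square≈0 (nonNegative-+-zeroˡ (nonNegative-square (im z)) (nonNegative-square (re z))
      (ℝ-Ring.trans (ℝ-Ring.+-comm _ _) e)))

  ∣0∣²≈0 : ∣ 0ᶜ ∣² ≈ʳ fromℚ 0ℚ
  ∣0∣²≈0 = ≈ʳ-pointwise λ n → ≡.refl

  -- The squared modulus is multiplicative and vanishes only at zero, which reduces the claim to the
  -- reals.
  ℂ-cancel : ∀ {z w} → ¬ z ≈ᶜ 0ᶜ → z *ᶜ w ≈ᶜ 0ᶜ → w ≈ᶜ 0ᶜ
  ℂ-cancel {z} {w} z≉0 e = ∣∣²≈0⇒≈0 (ℝ-cancel (λ h → z≉0 (∣∣²≈0⇒≈0 h))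
    (ℝ-Ring.trans (ℝ-Ring.sym (∣∣²-* z w)) (ℝ-Ring.trans (∣∣²-cong e) ∣0∣²≈0)))

  ℂ-1≉0 : ¬ 1ᶜ ≈ᶜ 0ᶜ
  ℂ-1≉0 e = ℝ-1≉0 (re-≈ e)

  ℂ-2≉0 : ¬ 1ᶜ +ᶜ 1ᶜ ≈ᶜ 0ᶜ
  ℂ-2≉0 e = ℝ-2≉0 (re-≈ e)

  ℂ-stable : ∀ {z w} → ¬ ¬ z ≈ᶜ w → z ≈ᶜ w
  ℂ-stable {z} {w} h = x∙y⁻¹≈ε⇒x≈y z w (mk≈ᶜ
    (≈0-stable λ k → h λ e → k (re-≈ (x≈y⇒x∙y⁻¹≈ε e)))
    (≈0-stable λ k → h λ e → k (im-≈ (x≈y⇒x∙y⁻¹≈ε e))))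
    where open RingProperties ℂ-Ring.ring using (x∙y⁻¹≈ε⇒x≈y; x≈y⇒x∙y⁻¹≈ε)

  -- z ∙ w is the real part of conj z * w.
  infixl 7 _∙_
  _∙_ : ℂ → ℂ → ℝ
  z ∙ w = re z *ʳ re w +ʳ im z *ʳ im w

  -- This identity stands in for the equality case of the triangle inequality: when `b` is no longer
  -- than `a`, the left side is a sum of two nonnegative reals, while the right side is linear in
  -- the difference and can be summed.
  ∣∣²-difference : ∀ a b → ∣ a +ᶜ -ᶜ b ∣² +ʳ (∣ a ∣² +ʳ -ʳ ∣ b ∣²) ≈ʳ (a +ᶜ a) ∙ (a +ᶜ -ᶜ b)
  ∣∣²-difference a b = ≈ʳ-pointwise λ n → solve 4 (λ a b c d →
    ((a :+ :- c) :* (a :+ :- c) :+ (b :+ :- d) :* (b :+ :- d)) :+ ((a :* a :+ b :* b) :+ :- (c :* c :+ d :* d)) :=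
    (a :+ a) :* (a :+ :- c) :+ (b :+ b) :* (b :+ :- d))
    ≡.refl (seq (re a) n) (seq (im a) n) (seq (re b) n) (seq (im b) n)

  ∙-distribˡ-+ : ∀ z v w → z ∙ (v +ᶜ w) ≈ʳ z ∙ v +ʳ z ∙ w
  ∙-distribˡ-+ z v w = ≈ʳ-pointwise λ n → solve 6 (λ a b c d e f →
    a :* (c :+ e) :+ b :* (d :+ f) := (a :* c :+ b :* d) :+ (a :* e :+ b :* f))
    ≡.refl (seq (re z) n) (seq (im z) n) (seq (re v) n) (seq (im v) n) (seq (re w) n) (seq (im w) n)

  ∙-zeroʳ : ∀ z → z ∙ 0ᶜ ≈ʳ fromℚ 0ℚ
  ∙-zeroʳ z = ≈ʳ-pointwise λ n → solve 2 (λ a b → a :* con 0ℚ :+ b :* con 0ℚ := con 0ℚ)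
    ≡.refl (seq (re z) n) (seq (im z) n)

  ∙-congʳ : ∀ z {v w} → v ≈ᶜ w → z ∙ v ≈ʳ z ∙ w
  ∙-congʳ z e = ℝ-Ring.+-cong (ℝ-Ring.*-congˡ (re-≈ e)) (ℝ-Ring.*-congˡ (im-≈ e))

  *-conj : ∀ z → z *ᶜ conj z ≈ᶜ record { re = ∣ z ∣² ; im = fromℚ 0ℚ }
  *-conj z = mk≈ᶜ
    (≈ʳ-pointwise λ n → solve 2 (λ a b → a :* a :+ :- (b :* :- b) := a :* a :+ b :* b)
      ≡.refl (seq (re z) n) (seq (im z) n))
    (≈ʳ-pointwise λ n → solve 2 (λ a b → a :* :- b :+ b :* a := con 0ℚ)
      ≡.refl (seq (re z) n) (seq (im z) n))

  𝕋-inverseʳ : ∀ u → val u *ᶜ conj (val u) ≈ᶜ 1ᶜ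
  𝕋-inverseʳ u = ℂ-Ring.trans (*-conj (val u)) (mk≈ᶜ (𝕋.unit u) ℝ-Ring.refl)

-- Gain digraphs

open ℂ-Ring hiding (zero; _≈_)
open RingProperties ring
  using (x≈y⇒x∙y⁻¹≈ε; x∙y⁻¹≈ε⇒x≈y; -0#≈0#; -‿injective; -‿distribˡ-*; -‿distribʳ-*)
open SemiringSum semiring using (sum; sum-cong-≋; ∑-distrib-+)
open SetoidReasoning setoid
open import Algebra.Solver.Ring.NaturalCoefficients.Default commutativeSemiring
  using (solve; _:+_; _:*_; _:=_)
open RawMonoidDefinitions +-rawMonoid using () renaming (_×_ to _×ᶜ_)
open Determinants ℂ-commutativeRing
open Domain ℂ-1≉0 ℂ-2≉0 ℂ-cancel
open CharacteristicPolynomials ℂ-commutativeRing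
open LinearAlgebra ℂ-Ring.rawRing using (det)

𝕋-inverseˡ : ∀ u → conj (val u) *ᶜ val u ≈ᶜ 1ᶜ
𝕋-inverseˡ u = trans (*-comm _ _) (𝕋-inverseʳ u)

if-T : ∀ {a} {A : Set a} {b} {x y : A} → T b → (if b then x else y) ≡ x
if-T {b = true} _ = ≡.refl

if-¬T : ∀ {a} {A : Set a} {b} {x y : A} → ¬ T b → (if b then x else y) ≡ y
if-¬T {b = true}  ¬t = contradiction _ ¬t
if-¬T {b = false} ¬t = ≡.refl

-- Distributes the degree term of the Laplacian over the out-neighbours, to be merged with the
-- adjacency term arc by arc.
count-sum : ∀ {n} (f : Fin n → Bool) z →
  (∣ tabulate f ∣ ×ᶜ 1ᶜ) *ᶜ z ≈ᶜ sum λ j → if f j then z else 0ᶜ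
count-sum {zero}  f z = zeroˡ z
count-sum {suc n} f z with f zero
... | true  = trans (distribʳ z _ _) (+-cong (*-identityˡ z) (count-sum (f ∘ suc) z))
... | false = trans (count-sum (f ∘ suc) z) (sym (+-identityˡ _))

module Gains {n} {D : Digraph n} (Φ : GainDigraph D) where
  open Digraph D hiding (StronglyConnected; laplacian)
  open import Data.List.Membership.DecPropositional (Fin._≟_ {n}) using (_∈?_)
  open GainDigraph Φ using (gain; walkGain; gainAdjacency)

  weight : ∀ {i j} → Walk i j → ℂ
  weight w = val (walkGain w)

  weight-◅◅ : ∀ {i j k} (w : Walk i j) (v : Walk j k) → weight (w ◅◅ v) ≈ᶜ weight w *ᶜ weight v
  weight-◅◅ ε       v = sym (*-identityˡ _)
  weight-◅◅ (a ◅ w) v = trans (*-congˡ (weight-◅◅ w v)) (sym (*-assoc _ _ _))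

  -- Loop erasure in walks of a cycle balanced gain digraph

  module LoopErasure (balanced : CycleBalanced Φ) where

    -- A path cut at its vertex `i`. By `simple`, an arc from `i` to `k` followed by `before` is a
    -- cycle; `visited` keeps the vertices of `before` fresh when the path is extended at its start.
    record Split {k j} (p : Walk k j) (i : Fin n) : Set where
      field
        before  : Walk k i
        after   : Walk i j
        path    : IsPath after
        simple  : Unique (i ∷ sources before)
        visited : ∀ {v} → v ∈ sources before → v ∈ sources p ∷ʳ j
        weights : weight p ≈ᶜ weight before *ᶜ weight after

    split : ∀ {k j} (p : Walk k j) {i} → IsPath p → i ∈ sources p ∷ʳ j → Split p i
    split ε path (here ≡.refl) = record
      { before = ε ; after = ε ; path = path ; simple = [] ∷ [] ; visited = λ ()
      ; weights = sym (*-identityˡ _) }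
    split (a ◅ p) path (here ≡.refl) = record
      { before = ε ; after = a ◅ p ; path = path ; simple = [] ∷ [] ; visited = λ ()
      ; weights = sym (*-identityˡ _) }
    split (a ◅ p) (fresh ∷ path) (there i∈p) with split p path i∈p
    ... | record { before = q ; after = r ; path = path′ ; simple = i∉q ∷ simple-q
                 ; visited = visited ; weights = weights } = record
      { before  = a ◅ q
      ; after   = r
      ; path    = path′
      ; simple  = ((λ i≡k → All.lookup fresh i∈p (≡.sym i≡k)) ∷ i∉q)
                ∷ All.tabulate (λ v∈q → All.lookup fresh (visited v∈q)) ∷ simple-q
      ; visited = λ { (here e) → here e ; (there v∈q) → there (visited v∈q) }
      ; weights = trans (*-congˡ weights) (sym (*-assoc _ _ _))
      }

    -- First make the tail a path. If it meets `i` again, the new arc together with the part up to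
    -- `i` is a cycle of gain 1 and is dropped.
    erase : ∀ {i j} (w : Walk i j) → ∃ λ (p : Walk i j) → IsPath p × weight p ≈ᶜ weight w
    erase ε = ε , [] ∷ [] , refl
    erase {i} {j} (a ◅ w) with erase w
    ... | p , path , e with i ∈? (sources p ∷ʳ j)
    ... | no i∉p = a ◅ p
      , All.tabulate (λ {v} v∈p i≡v → i∉p (≡.subst (_∈ _) (≡.sym i≡v) v∈p)) ∷ path
      , *-congˡ e
    ... | yes i∈p = after , path′ , sym (begin
        weight (a ◅ w)                             ≈⟨ *-congˡ (trans (sym e) weights) ⟩
        val (gain _ _ a) *ᶜ (weight before *ᶜ weight after) ≈⟨ sym (*-assoc _ _ _) ⟩
        weight (a ◅ before) *ᶜ weight after
          ≈⟨ *-congʳ (balanced (a ◅ before) (s≤s z≤n , simple)) ⟩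
        1ᶜ *ᶜ weight after                         ≈⟨ *-identityˡ _ ⟩
        weight after                               ∎)
      where open Split (split p path i∈p) renaming (path to path′)

    -- A closed path is empty, since otherwise its first vertex would occur again as its last.
    closed-path-weight : ∀ {i} (p : Walk i i) → IsPath p → weight p ≈ᶜ 1ᶜ
    closed-path-weight ε       _           = refl
    closed-path-weight (a ◅ p) (fresh ∷ _) =
      contradiction ≡.refl (All.lookup fresh (∈-++⁺ʳ (sources p) (here ≡.refl)))

    closed-weight : ∀ {i} (w : Walk i i) → weight w ≈ᶜ 1ᶜ
    closed-weight w with erase w
    ... | p , path , e = trans (sym e) (closed-path-weight p path)

  -- With `ψ v` the gain of a chosen walk from the root to `v`, one return walk from `j` closes both
  -- the walk through the arc and the chosen walk to `j`. Both closed walks have gain 1, and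
  -- comparing them isolates the gain of the arc.
  balanced⇒potential : StronglyConnected D → Fin n → CycleBalanced Φ → HasPotential Φ
  balanced⇒potential connected root balanced = ψ , λ i j a →
    let g = val (ψ i) ; h = val (ψ j) ; φ = val (gain i j a)
        back = proj₁ (connected j root)
        b = weight back
        gφb≈1 : g *ᶜ (φ *ᶜ b) ≈ᶜ 1ᶜ
        gφb≈1 = trans (sym (weight-◅◅ (to i) (a ◅ back))) (closed-weight (to i ◅◅ (a ◅ back)))
        hb≈1 : h *ᶜ b ≈ᶜ 1ᶜ
        hb≈1 = trans (sym (weight-◅◅ (to j) back)) (closed-weight (to j ◅◅ back))
    in begin
      φ                                          ≈⟨ sym (trans (*-cong (𝕋-inverseˡ (ψ i)) (*-congˡ hb≈1)) (trans (*-identityˡ _) (*-identityʳ _))) ⟩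
      (conj g *ᶜ g) *ᶜ (φ *ᶜ (h *ᶜ b))
        ≈⟨ solve 5 (λ c g φ h b → (c :* g) :* (φ :* (h :* b)) := c :* h :* (g :* (φ :* b)))
             refl (conj g) g φ h b ⟩
      conj g *ᶜ h *ᶜ (g *ᶜ (φ *ᶜ b))             ≈⟨ *-congˡ gφb≈1 ⟩
      conj g *ᶜ h *ᶜ 1ᶜ                          ≈⟨ *-identityʳ _ ⟩
      conj g *ᶜ h                                ∎
    where
    open LoopErasure balanced
    to : ∀ v → Walk root v
    to v = proj₁ (connected root v)
    ψ : Fin n → 𝕋
    ψ v = walkGain (to v)

  -- Along a walk the inner potentials cancel, and on a closed walk so do those of the two ends.
  potential⇒balanced : HasPotential Φ → CycleBalanced Φ
  potential⇒balanced (ψ , φ≈) {i} c _ = trans (telescope c) (𝕋-inverseˡ (ψ i))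
    where
    telescope : ∀ {i j} (w : Walk i j) → weight w ≈ᶜ conj (val (ψ i)) *ᶜ val (ψ j)
    telescope {i} ε = sym (𝕋-inverseˡ (ψ i))
    telescope {i} {j} (_◅_ {j = k} a w) = begin
      val (gain i k a) *ᶜ weight w                  ≈⟨ *-cong (φ≈ i k a) (telescope w) ⟩
      (conj p *ᶜ q) *ᶜ (conj q *ᶜ r)
        ≈⟨ solve 4 (λ a b c d → (a :* b) :* (c :* d) := a :* (b :* c) :* d) refl (conj p) q (conj q) r ⟩
      conj p *ᶜ (q *ᶜ conj q) *ᶜ r
        ≈⟨ *-congʳ (trans (*-congˡ (𝕋-inverseʳ (ψ k))) (*-identityʳ _)) ⟩
      conj p *ᶜ r                                   ∎
      where
      p = val (ψ i)
      q = val (ψ k)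
      r = val (ψ j)

  -- The potential itself is the switching function.
  potential⇒∼ : HasPotential Φ → Φ ∼ allOnes D
  potential⇒∼ (ψ , φ≈) = ψ , λ i j a →
    let p = val (ψ i) ; q = val (ψ j) in sym (begin
      p *ᶜ val (gain i j a) *ᶜ conj q        ≈⟨ *-congʳ (*-congˡ (φ≈ i j a)) ⟩
      p *ᶜ (conj p *ᶜ q) *ᶜ conj q
        ≈⟨ solve 4 (λ p c q d → p :* (c :* q) :* d := (p :* c) :* (q :* d)) refl p (conj p) q (conj q) ⟩
      (p *ᶜ conj p) *ᶜ (q *ᶜ conj q)         ≈⟨ *-cong (𝕋-inverseʳ (ψ i)) (𝕋-inverseʳ (ψ j)) ⟩
      1ᶜ *ᶜ 1ᶜ                               ≈⟨ *-identityˡ 1ᶜ ⟩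
      1ᶜ                                     ∎)

  ∼⇒potential : Φ ∼ allOnes D → HasPotential Φ
  ∼⇒potential (σ , 1≈) = σ , λ i j a →
    let p = val (σ i) ; q = val (σ j) ; φ = val (gain i j a) in begin
      φ                                        ≈⟨ sym (trans (*-congʳ (*-cong (𝕋-inverseˡ (σ i)) (𝕋-inverseˡ (σ j))))
             (trans (*-congʳ (*-identityˡ 1ᶜ)) (*-identityˡ φ))) ⟩
      (conj p *ᶜ p) *ᶜ (conj q *ᶜ q) *ᶜ φ
        ≈⟨ solve 5 (λ c p d q φ → (c :* p) :* (d :* q) :* φ := c :* q :* (p :* φ :* d)) refl (conj p) p (conj q) q φ ⟩
      conj p *ᶜ q *ᶜ (p *ᶜ φ *ᶜ conj q)        ≈⟨ *-congˡ (sym (1≈ i j a)) ⟩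
      conj p *ᶜ q *ᶜ 1ᶜ                        ≈⟨ *-identityʳ _ ⟩
      conj p *ᶜ q                              ∎

  -- The share of the arc from `i` to `j` in row `i` of `L(Φ) x`. The value `0ᶜ` off the arcs lets
  -- sums range over all vertices.
  defect : Vector ℂ n → Fin n → Fin n → ℂ
  defect x i j with T? (arc i j)
  ... | yes a = x i +ᶜ -ᶜ (val (gain i j a) *ᶜ x j)
  ... | no  _ = 0ᶜ

  defect≈0 : ∀ x i j (a : Arc i j) → defect x i j ≈ᶜ 0ᶜ → x i ≈ᶜ val (gain i j a) *ᶜ x j
  defect≈0 x i j a e with T? (arc i j)
  -- A gain takes a proof of the arc as argument; the proof found by `T?` is identified with the
  -- given one.
  ... | yes a′ = ≡.subst (λ a → x i ≈ᶜ val (gain i j a) *ᶜ x j)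
    (T-irrelevant a′ a) (x∙y⁻¹≈ε⇒x≈y _ _ e)
  ... | no ¬a  = contradiction a ¬a

  gainLaplacian-• : ∀ x i → (gainLaplacian Φ • x) i ≈ᶜ sum (defect x i)
  gainLaplacian-• x i = begin
    sum (λ j → (outDegrees i j +ᶜ -ᶜ gainAdjacency i j) *ᶜ x j)
      ≈⟨ sum-cong-≋ (λ j → distribʳ (x j) (outDegrees i j) (-ᶜ gainAdjacency i j)) ⟩
    sum (λ j → outDegrees i j *ᶜ x j +ᶜ -ᶜ gainAdjacency i j *ᶜ x j)
      ≈⟨ ∑-distrib-+ (λ j → outDegrees i j *ᶜ x j) (λ j → -ᶜ gainAdjacency i j *ᶜ x j) ⟩
    sum (λ j → outDegrees i j *ᶜ x j) +ᶜ sum (λ j → -ᶜ gainAdjacency i j *ᶜ x j)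
      ≈⟨ +-congʳ (trans (sum-single (λ j → outDegrees i j *ᶜ x j) i off) (trans on (count-sum (arc i) (x i)))) ⟩
    sum (λ j → if arc i j then x i else 0ᶜ) +ᶜ sum (λ j → -ᶜ gainAdjacency i j *ᶜ x j)
      ≈⟨ sym (∑-distrib-+ (λ j → if arc i j then x i else 0ᶜ) (λ j → -ᶜ gainAdjacency i j *ᶜ x j)) ⟩
    sum (λ j → (if arc i j then x i else 0ᶜ) +ᶜ -ᶜ gainAdjacency i j *ᶜ x j)
      ≈⟨ sum-cong-≋ term ⟩
    sum (defect x i) ∎
    where
    off : ∀ j → j ≢ i → outDegrees i j *ᶜ x j ≈ᶜ 0ᶜ
    off j j≢i with i Fin.≟ j
    ... | yes i≡j = contradiction (≡.sym i≡j) j≢i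
    ... | no _    = zeroˡ _
    on : outDegrees i i *ᶜ x i ≈ᶜ (deg⁺ i ×ᶜ 1ᶜ) *ᶜ x i
    on with i Fin.≟ i
    ... | yes _  = refl
    ... | no i≢i = contradiction ≡.refl i≢i
    term : ∀ j → (if arc i j then x i else 0ᶜ) +ᶜ -ᶜ gainAdjacency i j *ᶜ x j ≈ᶜ defect x i j
    term j with T? (arc i j)
    ... | yes a = +-cong (reflexive (if-T a)) (sym (-‿distribˡ-* _ _))
    ... | no ¬a = trans (+-cong (reflexive (if-¬T ¬a)) (trans (*-congʳ -0#≈0#) (zeroˡ _))) (+-identityˡ _)

  -- Conjugation by the diagonal matrix of `ψ`: the degrees are unchanged because the factor is 1 on
  -- the diagonal, and the arcs acquire exactly their gains.
  switched-laplacian : (pot : HasPotential Φ) → ∀ i j → let ψ = proj₁ pot in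
    gainLaplacian Φ i j ≈ᶜ conj (val (ψ i)) *ᶜ val (ψ j) *ᶜ Digraph.laplacian D i j
  switched-laplacian (ψ , φ≈) i j = trans
    (+-cong outDegree (trans (-‿cong adjacent) (-‿distribʳ-* _ _)))
    (sym (distribˡ _ _ _))
    where
    s = conj (val (ψ i)) *ᶜ val (ψ j)
    outDegree : outDegrees i j ≈ᶜ s *ᶜ outDegrees i j
    outDegree with i Fin.≟ j
    ... | yes ≡.refl = sym (trans (*-congʳ (𝕋-inverseˡ (ψ i))) (*-identityˡ _))
    ... | no _       = sym (zeroʳ _)
    adjacent : gainAdjacency i j ≈ᶜ s *ᶜ adjacency i j
    adjacent with T? (arc i j)
    ... | yes a = trans (φ≈ i j a) (sym (trans (*-congˡ (reflexive (if-T a))) (*-identityʳ _)))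
    ... | no ¬a = sym (trans (*-congˡ (reflexive (if-¬T ¬a))) (zeroʳ _))

  potential⇒cospectral : HasPotential Φ → Cospectral (gainLaplacian Φ) (Digraph.laplacian D)
  potential⇒cospectral pot@(ψ , _) = similar⇒cospectral (conj ∘ val ∘ ψ) (val ∘ ψ)
    (𝕋-inverseˡ ∘ ψ) (switched-laplacian pot)

  -- Each defect vanishes separately: the gain of an arc carries `conj` of the potential at its head
  -- to that at its tail.
  potential⇒gainLaplacian-kernel : (pot : HasPotential Φ) → ∀ i →
    (gainLaplacian Φ • (conj ∘ val ∘ proj₁ pot)) i ≈ᶜ 0ᶜ
  potential⇒gainLaplacian-kernel (ψ , φ≈) i =
    trans (gainLaplacian-• x i) (sum-zero λ j → vanish j)
    where
    x : Vector ℂ n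
    x = conj ∘ val ∘ ψ
    vanish : ∀ j → defect x i j ≈ᶜ 0ᶜ
    vanish j with T? (arc i j)
    ... | no _  = refl
    ... | yes a = x≈y⇒x∙y⁻¹≈ε (sym (begin
      val (gain i j a) *ᶜ x j             ≈⟨ *-congʳ (φ≈ i j a) ⟩
      conj (val (ψ i)) *ᶜ val (ψ j) *ᶜ x j  ≈⟨ *-assoc _ _ _ ⟩
      x i *ᶜ (val (ψ j) *ᶜ x j)           ≈⟨ *-congˡ (𝕋-inverseʳ (ψ j)) ⟩
      x i *ᶜ 1ᶜ                           ≈⟨ *-identityʳ _ ⟩
      x i                                 ∎))

  -- The maximum principle for kernel vectors of the gain Laplacian

  module MaximumModulus (x : Vector ℂ n) (Lx≈0 : ∀ i → (gainLaplacian Φ • x) i ≈ᶜ 0ᶜ) where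
    open SemiringSum ℝ-Ring.semiring using () renaming (sum to sumʳ)

    Maximal : Fin n → Set
    Maximal i = ∀ j → NonNegative (∣ x i ∣² +ʳ -ʳ ∣ x j ∣²)

    ∣gain*∣² : ∀ u z → ∣ val u *ᶜ z ∣² ≈ʳ ∣ z ∣²
    ∣gain*∣² u z = ℝ-Ring.trans (∣∣²-* (val u) z)
      (ℝ-Ring.trans (ℝ-Ring.*-congʳ (𝕋.unit u)) (ℝ-Ring.*-identityˡ _))

    difference : ∀ i j → Arc i j → ℂ
    difference i j a = x i +ᶜ -ᶜ (val (gain i j a) *ᶜ x j)

    -- Summed over j, the right-hand sides extend to 2 x i ∙ (L(Φ) x) i = 0, while the
    -- left-hand sides are nonnegative.
    surplus : ∀ i j (a : Arc i j) →
      ∣ difference i j a ∣² +ʳ (∣ x i ∣² +ʳ -ʳ ∣ x j ∣²) ≈ʳ (x i +ᶜ x i) ∙ difference i j a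
    surplus i j a = ℝ-Ring.trans
      (ℝ-Ring.+-congˡ (ℝ-Ring.+-congˡ (ℝ-Ring.-‿cong (ℝ-Ring.sym (∣gain*∣² (gain i j a) (x j))))))
      (∣∣²-difference (x i) (val (gain i j a) *ᶜ x j))

    defect-∙-nonNegative : ∀ i → Maximal i → ∀ j → NonNegative ((x i +ᶜ x i) ∙ defect x i j)
    defect-∙-nonNegative i max j with T? (arc i j)
    ... | yes a = nonNegative-resp-≈ (surplus i j a) (nonNegative-+ (∣∣²-nonNegative (difference i j a)) (max j))
    ... | no _  = nonNegative-resp-≈ (ℝ-Ring.sym (∙-zeroʳ (x i +ᶜ x i))) nonNegative-0

    defect-∙≈0⇒≈0 : ∀ i → Maximal i → ∀ j →
      (x i +ᶜ x i) ∙ defect x i j ≈ʳ fromℚ 0ℚ → defect x i j ≈ᶜ 0ᶜ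
    defect-∙≈0⇒≈0 i max j e with T? (arc i j)
    ... | yes a = ∣∣²≈0⇒≈0 {difference i j a} 
      (nonNegative-+-zeroˡ (∣∣²-nonNegative (difference i j a)) (max j)
        (ℝ-Ring.trans (surplus i j a) e))
    ... | no _  = refl

    ∙-sum : ∀ {m} z (f : Vector ℂ m) → z ∙ sum f ≈ʳ sumʳ (λ j → z ∙ f j)
    ∙-sum {zero}  z f = ∙-zeroʳ z
    ∙-sum {suc m} z f = ℝ-Ring.trans
      (∙-distribˡ-+ z (f zero) (sum (f ∘ suc)))
      (ℝ-Ring.+-congˡ (∙-sum z (f ∘ suc)))

    -- Nonnegative terms with sum zero all vanish, and by `surplus` a vanishing term forces its
    -- defect to vanish.
    harmonic : ∀ i → Maximal i → ∀ j (a : Arc i j) → x i ≈ᶜ val (gain i j a) *ᶜ x j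
    harmonic i max j a = defect≈0 x i j a (defect-∙≈0⇒≈0 i max j
      (nonNegative-sum-zero {f = λ k → 2xᵢ ∙ defect x i k} (defect-∙-nonNegative i max) total j))
      where
      2xᵢ = x i +ᶜ x i
      defects : sum (defect x i) ≈ᶜ 0ᶜ
      defects = trans (sym (gainLaplacian-• x i)) (Lx≈0 i)
      total : sumʳ (λ k → 2xᵢ ∙ defect x i k) ≈ʳ fromℚ 0ℚ
      total = ℝ-Ring.trans (ℝ-Ring.sym (∙-sum 2xᵢ (defect x i)))
        (ℝ-Ring.trans (∙-congʳ 2xᵢ {sum (defect x i)} {0ᶜ} defects) (∙-zeroʳ 2xᵢ))

    maximal-step : ∀ i → Maximal i → ∀ j → Arc i j → Maximal j
    maximal-step i max j a l = nonNegative-resp-≈ (ℝ-Ring.+-congʳ {z} {∣ x i ∣²} {∣ x j ∣²} same) (max l)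
      where
      z = -ʳ ∣ x l ∣²
      same : ∣ x i ∣² ≈ʳ ∣ x j ∣²
      same = ℝ-Ring.trans (∣∣²-cong {x i} {val (gain i j a) *ᶜ x j} (harmonic i max j a))
        (∣gain*∣² (gain i j a) (x j))

    maximal-walk : ∀ {i k} → Maximal i → Walk i k → Maximal k
    maximal-walk max ε       = max
    maximal-walk max (a ◅ w) = maximal-walk (maximal-step _ max _ a) w

    harmonic-walk : ∀ {i k} → Maximal i → (w : Walk i k) → x i ≈ᶜ weight w *ᶜ x k
    harmonic-walk         max ε                 = sym (*-identityˡ _)
    harmonic-walk {i} {k} max (_◅_ {j = j} a w) = begin
      x i                                        ≈⟨ harmonic i max j a ⟩
      val (gain i j a) *ᶜ x j
        ≈⟨ *-congˡ (harmonic-walk (maximal-step i max j a) w) ⟩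
      val (gain i j a) *ᶜ (weight w *ᶜ x k)
        ≈⟨ sym (*-assoc (val (gain i j a)) (weight w) (x k)) ⟩
      weight (a ◅ w) *ᶜ x k                      ∎

    -- Maximality reaches every vertex, so a zero at `i` would spread along walks to all of `x`.
    -- Hence `x i` can be cancelled from `x i ≈ weight c * x i`.
    balanced-of-maximal : StronglyConnected D → ¬ (∀ i → x i ≈ᶜ 0ᶜ) → ∀ m → Maximal m →
      CycleBalanced Φ
    balanced-of-maximal connected x≉0 m max {i} c _ =
      x∙y⁻¹≈ε⇒x≈y _ _ (ℂ-cancel xᵢ≉0 (begin
        x i *ᶜ (weight c +ᶜ -ᶜ 1ᶜ)         ≈⟨ *-comm _ _ ⟩
        (weight c +ᶜ -ᶜ 1ᶜ) *ᶜ x i         ≈⟨ distribʳ _ _ _ ⟩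
        weight c *ᶜ x i +ᶜ -ᶜ 1ᶜ *ᶜ x i
          ≈⟨ +-cong (sym (harmonic-walk (max-at i) c)) (trans (sym (-‿distribˡ-* _ _)) (-‿cong (*-identityˡ _))) ⟩
        x i +ᶜ -ᶜ x i                      ≈⟨ -‿inverseʳ _ ⟩
        0ᶜ                                 ∎))
      where
      max-at : ∀ k → Maximal k
      max-at k = maximal-walk max (proj₁ (connected m k))
      xᵢ≉0 : ¬ x i ≈ᶜ 0ᶜ
      xᵢ≉0 xᵢ≈0 = x≉0 λ k → trans (harmonic-walk (max-at k) (proj₁ (connected k i)))
        (trans (*-congˡ xᵢ≈0) (zeroʳ _))

  kernel⇒balanced : StronglyConnected D → Fin n → (x : Vector ℂ n) → ¬ (∀ i → x i ≈ᶜ 0ᶜ) →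
    (∀ i → (gainLaplacian Φ • x) i ≈ᶜ 0ᶜ) → CycleBalanced Φ
  kernel⇒balanced connected root x x≉0 Lx≈0 c cycle = ℂ-stable λ ≉1 →
    ¬¬-maximum root (λ i → ∣ x i ∣²) λ (m , max) →
      ≉1 (MaximumModulus.balanced-of-maximal x Lx≈0 connected x≉0 m max c cycle)

module _ {n} (D : Digraph n) where
  open Digraph D using (adjacency; outDegrees; arc)

  laplacian-• : ∀ x i → (Digraph.laplacian D • x) i ≈ᶜ (gainLaplacian (allOnes D) • x) i
  laplacian-• x i = sum-cong-≋ λ j → *-congʳ {x j} (+-congˡ (-‿cong (adjacent j)))
    where
    adjacent : ∀ j → adjacency i j ≈ᶜ GainDigraph.gainAdjacency (allOnes D) i j
    adjacent j with T? (arc i j)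
    ... | yes a = reflexive (if-T a)
    ... | no ¬a = reflexive (if-¬T ¬a)

  laplacian-row-sum : ∀ i → (Digraph.laplacian D • (λ _ → 1ᶜ)) i ≈ᶜ 0ᶜ
  laplacian-row-sum i = begin
    (Digraph.laplacian D • (λ _ → 1ᶜ)) i                 ≈⟨ laplacian-• (λ _ → 1ᶜ) i ⟩
    (gainLaplacian (allOnes D) • (λ _ → 1ᶜ)) i
      ≈⟨ Gains.gainLaplacian-• (allOnes D) (λ _ → 1ᶜ) i ⟩
    sum (Gains.defect (allOnes D) (λ _ → 1ᶜ) i)          ≈⟨ sum-zero vanish ⟩
    0ᶜ                                                   ∎
    where
    vanish : ∀ j → Gains.defect (allOnes D) (λ _ → 1ᶜ) i j ≈ᶜ 0ᶜ
    vanish j with T? (arc i j)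
    ... | yes _ = x≈y⇒x∙y⁻¹≈ε (sym (*-identityˡ 1ᶜ))
    ... | no _  = refl

negated-• : ∀ {n} (A : Matrix ℂ n) x i → ((λ i j → -ᶜ A i j) • x) i ≈ᶜ -ᶜ (A • x) i
negated-• A x i = trans (sum-cong-≋ λ j → sym (-‿distribˡ-* (A i j) (x j)))
  (sum-neg λ j → A i j *ᶜ x j)

-- The constant coefficient is the determinant of the negated Laplacian, so negated matrices are
-- used throughout and no power of -1 has to be extracted. The all-ones vector makes the one of `D`
-- singular.
cospectral⇒balanced : ∀ {n} {D : Digraph n} (Φ : GainDigraph D) → StronglyConnected D → Fin n →
  Cospectral (gainLaplacian Φ) (laplacian D) → CycleBalanced Φ
cospectral⇒balanced {n} {D} Φ connected root cospectral c cycle = ℂ-stable λ ≉1 →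
  singular⇒kernel (λ i j → -ᶜ gainLaplacian Φ i j) singular λ (x , (k , xₖ≉0) , -Lx≈0) →
    ≉1 (Gains.kernel⇒balanced Φ connected root x (λ x≈0 → xₖ≉0 (x≈0 k))
      (λ i → -‿injective (trans (sym (negated-• (gainLaplacian Φ) x i)) (trans (-Lx≈0 i) (sym -0#≈0#))))
      c cycle)
  where
  singular : det (λ i j → -ᶜ gainLaplacian Φ i j) ≈ᶜ 0ᶜ
  singular = begin
    det (λ i j → -ᶜ gainLaplacian Φ i j)  ≈⟨ sym (coeff₀-charPoly (gainLaplacian Φ)) ⟩
    _                                     ≈⟨ cospectral 0 ⟩
    _                                     ≈⟨ coeff₀-charPoly (laplacian D) ⟩
    det (λ i j → -ᶜ laplacian D i j)
      ≈⟨ kernel⇒singular (λ i j → -ᶜ laplacian D i j) ((λ _ → 1ᶜ) , (root , ℂ-1≉0) , λ i →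
           trans (negated-• (laplacian D) _ i) (trans (-‿cong (laplacian-row-sum D i)) -0#≈0#)) ⟩
    0ᶜ                                    ∎

theorem5p3 : ∀ (n : ℕ) .{{_ : NonZero n}} (D : Digraph n) (Φ : GainDigraph D) →
    StronglyConnected D →
    (CycleBalanced Φ ⇔ Φ ∼ allOnes D) ×
    (Φ ∼ allOnes D ⇔ HasPotential Φ) ×
    (Φ ∼ allOnes D ⇔ Cospectral (gainLaplacian Φ) (laplacian D)) ×
    (Cospectral (gainLaplacian Φ) (laplacian D) ⇔ IsEigenvalue 0ᶜ (gainLaplacian Φ))
-- A nonempty vertex set provides `zero` as the root and as the coordinate at which the eigenvector
-- is seen to be nonzero.
theorem5p3 (suc n) D Φ connected =
  mk⇔ (potential⇒∼ ∘ potential) (λ s → potential⇒balanced (∼⇒potential s)) ,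
  mk⇔ ∼⇒potential potential⇒∼ ,
  mk⇔ (potential⇒cospectral ∘ ∼⇒potential) (λ h → potential⇒∼ (potential (balanced h))) ,
  mk⇔ (λ h → eigenvector (potential (balanced h)))
      (λ (x , x≉0 , Lx≈0x) → potential⇒cospectral (potential
        (kernel⇒balanced connected zero x x≉0 λ i → trans (Lx≈0x i) (zeroˡ _))))
  where
  open Gains Φ
  potential : CycleBalanced Φ → HasPotential Φ
  potential = balanced⇒potential connected zero
  balanced : Cospectral (gainLaplacian Φ) (laplacian D) → CycleBalanced Φ
  balanced = cospectral⇒balanced Φ connected zero
  eigenvector : HasPotential Φ → IsEigenvalue 0ᶜ (gainLaplacian Φ)
  eigenvector pot@(ψ , _) = conj ∘ val ∘ ψ
    , (λ ψ≈0 → ℂ-1≉0 (trans (sym (𝕋-inverseʳ (ψ zero))) (trans (*-congˡ (ψ≈0 zero)) (zeroʳ _))))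
    , λ i → trans (potential⇒gainLaplacian-kernel pot i) (sym (zeroˡ _))
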